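{- For any $\delta > 0$, there exists a token swapping instance $K$ such that, for any locally optimal swap sequence that brings every token of $K$ from its starting vertex to its target vertex, the length $k$ of the sequence satisfies $(4 - \delta) \cdot OPT(K) \leq k$.
   Context: A Token Swapping instance $K = (G, T, f_1, f_2)$ consists of an undirected graph $G = (V,E)$, a set of (distinct) tokens $T$ with $|T| = |V|$, and two one-to-one assignments $f_1, f_2 : T \to V$, called the starting and target configurations respectively. The destination (target vertex) of a token $t$ is $f_2(t)$. A swap along an edge $(u,v) \in E$ switches the locations of the tokens currently on $u$ and $v$. $OPT(K)$ denotes the length (number of swaps) of the shortest swap sequence that transforms the starting configuration into the target configuration. A swap sequence is locally optimal if no swap in it, say between tokens $t_1$ and $t_2$, moves both $t_1$ and $t_2$ further from their destinations (distances are graph distances in $G$). -}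

module Defs where

open import Data.Fin.Base using (Fin)
open import Data.Fin.Properties using (inj⇒≟)
open import Data.List.Base using (List; []; _∷_; length)
open import Data.Nat.Base using (ℕ; zero; suc; _≤_; _<_)
open import Data.Product.Base using (Σ-syntax; ∃-syntax; _×_; _,_)
open import Data.Unit.Base using (⊤)
open import Function.Bundles using (_↔_; _↣_; Injection)
open import Function.Properties.Inverse using (↔⇒↣)
open import Level using (0ℓ)
open import Relation.Binary.Core using (Rel)
open import Relation.Binary.Definitions
  using (Decidable; DecidableEquality; Irreflexive; Symmetric)
open import Relation.Binary.PropositionalEquality.Core using (_≡_)
open import Relation.Nullary.Decidable.Core using (yes; no)
open import Relation.Nullary.Negation.Core using (¬_)

IsLeast : (ℕ → Set) → ℕ → Set
IsLeast P n = P n × (∀ m → P m → n ≤ m)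

record Graph : Set₁ where
  field
    Vertex   : Set
    order    : ℕ
    finite   : Vertex ↔ Fin order
    Adj      : Rel Vertex 0ℓ
    adj?     : Decidable Adj
    symm     : Symmetric Adj
    loopless : Irreflexive _≡_ Adj

  infix 4 _≟ᵛ_
  _≟ᵛ_ : DecidableEquality Vertex
  _≟ᵛ_ = inj⇒≟ (↔⇒↣ finite)

  data Walk : Vertex → Vertex → ℕ → Set where
    nil  : ∀ {u} → Walk u u zero
    cons : ∀ {u v w n} → Adj u v → Walk v w n → Walk u w (suc n)

  -- The distance is a relation rather than a function because G need not be
  -- connected: no d satisfies IsDistance u v d when v is unreachable from u.
  IsDistance : Vertex → Vertex → ℕ → Set
  IsDistance u v = IsLeast (Walk u v)

  MovesFurther : (from to destination : Vertex) → Set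
  MovesFurther u v x =
    ∃[ d ] ∃[ d′ ] IsDistance u x d × IsDistance v x d′ × d < d′

record Instance : Set₁ where
  field
    graph : Graph
  open Graph graph public
  field
    Token  : Set
    tokens : Token ↔ Fin order
    start  : Token ↣ Vertex
    target : Token ↣ Vertex

  Configuration : Set
  Configuration = Token → Vertex

  startConfiguration : Configuration
  startConfiguration = Injection.to start

  destination : Token → Vertex
  destination = Injection.to target

  Swap : Set
  Swap = Σ[ u ∈ Vertex ] Σ[ v ∈ Vertex ] Adj u v

  applySwap : Swap → Configuration → Configuration
  applySwap (u , v , _) f t with f t ≟ᵛ u
  ... | yes _ = v
  ... | no  _ with f t ≟ᵛ v
  ...   | yes _ = u
  ...   | no  _ = f t

  -- The head of the list is the first swap performed.
  applySwaps : List Swap → Configuration → Configuration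
  applySwaps []       f = f
  applySwaps (s ∷ ss) f = applySwaps ss (applySwap s f)

  Solves : List Swap → Set
  Solves ss = ∀ t → applySwaps ss startConfiguration t ≡ destination t

  -- Swapping t₁ (on u) with t₂ (on v) in configuration f takes both of them
  -- strictly further from their destinations.
  MovesBothFurther : Configuration → Swap → Set
  MovesBothFurther f (u , v , _) =
    ∃[ t₁ ] ∃[ t₂ ] f t₁ ≡ u × f t₂ ≡ v
      × MovesFurther u v (destination t₁)
      × MovesFurther v u (destination t₂)

  LocallyOptimalFrom : Configuration → List Swap → Set
  LocallyOptimalFrom f []       = ⊤
  LocallyOptimalFrom f (s ∷ ss) =
    ¬ MovesBothFurther f s × LocallyOptimalFrom (applySwap s f) ss

  LocallyOptimal : List Swap → Set
  LocallyOptimal = LocallyOptimalFrom startConfiguration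

  IsOPT : ℕ → Set
  IsOPT = IsLeast (λ k → Σ[ ss ∈ List Swap ] Solves ss × length ss ≡ k)

{-# OPTIONS --safe #-}

-- Take s copies of the complete graph on k terminals (layers) with every edge subdivided into
-- r = 2R segments, and a hub: a star with k branches of length R, the end of branch i being joined to
-- the i-th terminal of every layer.  In each layer the token on terminal i has to go to terminal
-- i + 1 mod k.  Two terminals are at distance r both in their layer and through the hub, so a swap
-- between a layer and the hub takes both tokens further from their destinations, and a locally
-- optimal sequence never leaves the layers.
--
-- Inside a layer, delete from the sequence both swaps of any two tokens that meet twice.  The other
-- tokens on a subdivided edge must end where they began; so whenever one token traverses the edge,
-- another one has to, which costs 2r - 1 swaps.  The traversed edges connect all terminals, so there
-- are at least k - 1 of them: in total s (k - 1)(2r - 1) swaps.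
--
-- Through the hub, let the branches act in turn as queues: a terminal token is pulled to the centre
-- while the tokens behind it move outwards, then it enters the next branch.  With s = kR + 1 it
-- leaves that branch just when the terminal of its own layer is due, and (k + 1) s (R + 1) swaps
-- suffice.  For k = R the quotient of the two lengths tends to 4.
module Submission where

open import Algebra.Properties.CommutativeMonoid.Sum as Sum using ()
open import Data.Fin.Base
  using (Fin; zero; suc; toℕ; fromℕ; inject₁; punchIn; punchOut)
open import Data.Fin.Induction using (<-weakInduction; >-weakInduction)
open import Data.Fin.Permutation using (permutation)
import Data.Fin.Properties as Finₚ
open import Data.Fin.Relation.Unary.Top using (view; ‵fromℕ; ‵inject₁)
open import Data.Integer.Base as ℤ using (ℤ)
import Data.Integer.Properties as ℤₚ
import Data.Integer.Tactic.RingSolver as ℤ-Solver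
open import Data.List.Base
  using (List; []; _∷_; length; _++_; map; filter; allFin; cartesianProduct)
open import Data.List.Membership.Propositional using (_∈_)
open import Data.List.Membership.Propositional.Properties
  using (∈-filter⁺; ∈-filter⁻; ∈-map⁺; ∈-map⁻; ∈-cartesianProduct⁺; ∈-allFin)
import Data.List.Properties as Listₚ
open import Data.List.Relation.Unary.All as All using (All; []; _∷_)
open import Data.List.Relation.Unary.Any using (here; there)
open import Data.List.Relation.Unary.Unique.Propositional using (Unique; []; _∷_)
import Data.List.Relation.Unary.Unique.Propositional.Properties as Uniqueₚ
open import Data.Maybe.Base using (Maybe; just; nothing)
import Data.Maybe.Properties as Maybeₚ
open import Data.Nat.Base using (ℕ; zero; suc)
import Data.Nat.Base as ℕ
open import Data.Nat.Coprimality using (Coprime)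
open import Data.Nat.DivMod
  using (_mod_; m≡m%n+[m/n]*n; m<n⇒m%n≡m; [m+kn]%n≡m%n; m%n<n; %-distribˡ-+; m%n%n≡m%n; n%n≡0)
open import Data.Nat.Divisibility using (_∣_; divides; ∣m+n∣m⇒∣n; ∣⇒≤; m∣m*n; n∣m*n)
import Data.Nat.Properties as ℕₚ
import Data.Nat.Tactic.RingSolver as ℕ-Solver
open import Data.Product.Base using (Σ-syntax; ∃-syntax; _×_; _,_; proj₁; proj₂)
open import Data.Product.Function.NonDependent.Propositional using (_×-↔_)
import Data.Product.Properties as Productₚ
import Data.Rational.Base as ℚ
import Data.Rational.Properties as ℚₚ
open import Data.Rational.Unnormalised.Base as ℚᵘ using (mkℚᵘ; *≤*)
import Data.Rational.Unnormalised.Properties as ℚᵘₚ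
open import Data.Sum.Base using (_⊎_; inj₁; inj₂; fromInj₂)
open import Data.Sum.Function.Propositional using (_⊎-↔_)
open import Data.Unit.Base using (tt)
open import Function.Base using (_∘_; id)
open import Function.Bundles using (_↔_; Inverse; mk↔ₛ′; mk↣)
open import Function.Construct.Composition using (_↔-∘_)
open import Function.Construct.Identity using (↔-id; ↣-id)
open import Function.Construct.Symmetry using (↔-sym)
open import Function.Definitions using (Injective)
open import Function.Properties.Inverse using (↔⇒↣)
open import Level using (0ℓ)
open import Relation.Binary.Definitions using (DecidableEquality)
open import Relation.Binary.PropositionalEquality
open import Relation.Nullary.Decidable
  using (Dec; yes; no; ¬?; _×-dec_; _⊎-dec_; map′; decidable-stable)
open import Relation.Nullary.Negation using (¬_; contradiction)
open import Relation.Unary using (Pred; Decidable)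
open import Algebra.Properties.AbelianGroup ℤₚ.+-0-abelianGroup using (identityʳ-unique)
open import Algebra.Properties.CommutativeSemigroup ℕₚ.+-commutativeSemigroup using (interchange)

open import Defs

-- Finite types and exhaustive search

module FiniteTypes where
  open import Data.Nat.Base using (_+_; _*_)

  Finite : Set → Set
  Finite A = ∃[ n ] A ↔ Fin n

  finite-Fin : ∀ n → Finite (Fin n)
  finite-Fin n = n , ↔-id _

  finite-⊎ : ∀ {A B} → Finite A → Finite B → Finite (A ⊎ B)
  finite-⊎ (m , f) (n , g) = m + n , (↔-sym Finₚ.+↔⊎ ↔-∘ (f ⊎-↔ g))

  finite-× : ∀ {A B} → Finite A → Finite B → Finite (A × B)
  finite-× (m , f) (n , g) = m * n , (↔-sym Finₚ.*↔× ↔-∘ (f ×-↔ g))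

  finite-↔ : ∀ {A B} → A ↔ B → Finite B → Finite A
  finite-↔ f (n , g) = n , (g ↔-∘ f)

  finite-∃? : ∀ {A} → Finite A → ∀ {P : Pred A 0ℓ} → Decidable P → Dec (∃[ x ] P x)
  finite-∃? (n , f) {P} P? = map′ (λ (i , p) → I.from i , p)
    (λ (x , p) → I.to x , subst P (sym (I.strictlyInverseʳ x)) p) (Finₚ.any? (P? ∘ I.from))
    where module I = Inverse f

open FiniteTypes

-- Least natural numbers satisfying a predicate

module LeastWitness where
  open import Data.Nat.Base using (_≤_; _<_; z≤n; s≤s)

  -- No decision procedure for `P` is given, so a least witness exists only up to double negation:
  -- without one, induction on a bound refutes every witness. Distances obtained this way enter only
  -- refutations, where this suffices.
  ¬¬least : ∀ {P : ℕ → Set} n → P n → ¬ ¬ (∃[ m ] IsLeast P m)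
  ¬¬least {P} n p none = rec n n ℕₚ.≤-refl p
    where
    rec : ∀ b n → n ≤ b → ¬ P n
    rec zero    zero z≤n p = none (zero , p , λ _ _ → z≤n)
    rec (suc b) n n≤ p = none (n , p , λ m q → ℕₚ.≮⇒≥ λ m<n → rec b m (ℕₚ.≤-pred (ℕₚ.<-≤-trans m<n n≤)) q)

  IsLeast-exists : ∀ {P : ℕ → Set} → (∀ n → Dec (P n)) → ∀ n → P n → ∃[ m ] IsLeast P m × m ≤ n
  IsLeast-exists P? n p with P? 0
  IsLeast-exists P? n       p | yes p₀ = 0 , (p₀ , λ _ _ → z≤n) , z≤n
  IsLeast-exists P? zero    p | no ¬p₀ = contradiction p ¬p₀
  IsLeast-exists {P} P? (suc n) p | no ¬p₀ with IsLeast-exists (P? ∘ suc) n p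
  ... | m , (pm , least) , m≤n = suc m , (pm , above) , s≤s m≤n
    where
    above : ∀ l → P l → suc m ≤ l
    above zero    pl = contradiction pl ¬p₀
    above (suc l) pl = s≤s (least l pl)

open LeastWitness

-- Existence of the optimal length

module OptimalLength where
  open import Data.Nat.Base using (_≤_)

  module _ (K : Instance) where
    open Instance K

    private
      SolvableFrom : Configuration → ℕ → Set
      SolvableFrom f n = Σ[ ss ∈ List Swap ] (∀ t → applySwaps ss f t ≡ destination t) × length ss ≡ n

      -- For fixed `n` the search is finite: the endpoints of the first swap are tried in turn, and
      -- the rest is decided recursively.
      solvableFrom? : ∀ n f → Dec (SolvableFrom f n)
      solvableFrom? zero f with finite-∃? (order , tokens) (λ t → ¬? (f t ≟ᵛ destination t))
      ... | yes (t , wrong) = no λ { ([] , solved , _) → wrong (solved t) }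
      ... | no none = yes ([] , (λ t → decidable-stable (f t ≟ᵛ destination t) (λ wrong → none (t , wrong))) , refl)
      solvableFrom? (suc n) f = map′
        (λ { (u , v , a , ss , solved , len) → (u , v , a) ∷ ss , solved , cong suc len })
        (λ { ((u , v , a) ∷ ss , solved , len) → u , v , a , ss , solved , ℕₚ.suc-injective len })
        (finite-∃? (order , finite) λ u → finite-∃? (order , finite) λ v → first-swap? u v)
        where
        first-swap? : ∀ u v → Dec (Σ[ a ∈ Adj u v ] SolvableFrom (applySwap (u , v , a) f) n)
        first-swap? u v with adj? u v
        ... | no ¬a = no (¬a ∘ proj₁)
        -- `applySwap` ignores the adjacency proof, so a solution starting with `a′` is also one
        -- starting with `a`.
        ... | yes a = map′ (a ,_) (λ { (a′ , solution) → solution }) (solvableFrom? n (applySwap (u , v , a) f))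

    OPT-exists : ∀ ss → Solves ss → ∃[ opt ] IsOPT opt × opt ≤ length ss
    OPT-exists ss solves =
      IsLeast-exists (λ n → solvableFrom? n startConfiguration) (length ss) (ss , solves , refl)

open OptimalLength

-- Counting by fibres, and the number of edges of a connected graph

module Counting where
  open import Data.Nat.Base using (_≤_; _+_; _*_; z≤n; s≤s)

  module _ {A K : Set} (_≟_ : DecidableEquality K) (key : A → K) where

    fibre : K → List A → List A
    fibre κ = filter (λ x → key x ≟ κ)

    private
      others : K → List A → List A
      others κ = filter (λ x → ¬? (key x ≟ κ))

      length-partition : ∀ κ xs → length (fibre κ xs) + length (others κ xs) ≡ length xs
      length-partition κ [] = refl
      length-partition κ (x ∷ xs) with key x ≟ κ
      ... | yes _ = cong suc (length-partition κ xs)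
      ... | no  _ = trans (ℕₚ.+-suc _ _) (cong suc (length-partition κ xs))

      fibre-others : ∀ {κ κ′} → κ ≢ κ′ → ∀ xs → fibre κ′ (others κ xs) ≡ fibre κ′ xs
      fibre-others κ≢κ′ [] = refl
      fibre-others {κ} {κ′} κ≢κ′ (x ∷ xs) with key x ≟ κ
      ... | yes refl with key x ≟ κ′
      ...   | yes eq = contradiction eq κ≢κ′
      ...   | no _   = fibre-others κ≢κ′ xs
      fibre-others {κ} {κ′} κ≢κ′ (x ∷ xs) | no _ with key x ≟ κ′
      ...   | yes _ = cong (x ∷_) (fibre-others κ≢κ′ xs)
      ...   | no _  = fibre-others κ≢κ′ xs

    -- Fibres are disjoint: removing the one over `κ` leaves those over the other keys unchanged, so
    -- their lengths add up. It serves to count swaps path by path and paths layer by layer.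
    fibres-bound : ∀ {m κs} → Unique κs → ∀ xs → (∀ {κ} → κ ∈ κs → m ≤ length (fibre κ xs)) →
                   length κs * m ≤ length xs
    fibres-bound []                xs large = z≤n
    fibres-bound {m} {κ ∷ κs} (κ∉ ∷ unique) xs large = begin
      m + length κs * m
        ≤⟨ ℕₚ.+-mono-≤ (large (here refl)) (fibres-bound unique (others κ xs) (λ κ′∈ →
             subst (λ l → m ≤ length l) (sym (fibre-others (All.lookup κ∉ κ′∈) xs)) (large (there κ′∈)))) ⟩
      length (fibre κ xs) + length (others κ xs)
        ≡⟨ length-partition κ xs ⟩
      length xs ∎
      where open ℕₚ.≤-Reasoning

  ∈⇒1≤length : ∀ {A : Set} {x : A} {xs} → x ∈ xs → 1 ≤ length xs
  ∈⇒1≤length (here _)  = s≤s z≤n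
  ∈⇒1≤length (there _) = s≤s z≤n

  -- With the identity as key, every element of `xs` has a nonempty fibre in `ys`.
  unique-⊆-length : ∀ {A : Set} → DecidableEquality A → ∀ {xs : List A} → Unique xs → ∀ ys →
                    (∀ {x} → x ∈ xs → x ∈ ys) → length xs ≤ length ys
  unique-⊆-length _≟_ {xs} unique ys sub = subst (_≤ length ys) (ℕₚ.*-identityʳ (length xs))
    (fibres-bound _≟_ id unique ys (λ {x} x∈ → ∈⇒1≤length (∈-filter⁺ (_≟ x) (sub x∈) refl)))

  Respects : ∀ {n} {C : Set} → (Fin n → C) → List (Fin n × Fin n) → Set
  Respects χ L = ∀ {a b} → (a , b) ∈ L → χ a ≡ χ b

  -- Every edge merges at most two colours.
  colouring : ∀ {n} (L : List (Fin n × Fin n)) →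
    ∃[ c ] Σ[ χ ∈ (Fin n → Fin c) ] (∀ y → ∃[ x ] χ x ≡ y) × Respects χ L × n ≤ length L + c
  colouring {n} [] = n , id , (λ y → y , refl) , (λ ()) , ℕₚ.≤-refl
  colouring ((a , b) ∷ L) with colouring L
  ... | c , χ , surj , respects , n≤ with χ a Finₚ.≟ χ b
  ...   | yes same = c , χ , surj , (λ { (here refl) → same ; (there e) → respects e }) , ℕₚ.m≤n⇒m≤1+n n≤
  colouring {n} ((a , b) ∷ L) | zero , χ , _ | no _ = contradiction (χ a) λ ()
  colouring {n} ((a , b) ∷ L) | suc c , χ , surj , respects , n≤ | no χa≢χb =
    c , merge ∘ χ , surjective , respects′ , ℕₚ.≤-trans n≤ (ℕₚ.≤-reflexive (ℕₚ.+-suc (length L) c))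
    where
    -- The colour `χ b` is replaced by `χ a` and then deleted from the palette.
    merge : Fin (suc c) → Fin c
    merge x with χ b Finₚ.≟ x
    ... | yes _    = punchOut (χa≢χb ∘ sym)
    ... | no  χb≢x = punchOut χb≢x
    merge-b : merge (χ b) ≡ punchOut (χa≢χb ∘ sym)
    merge-b with χ b Finₚ.≟ χ b
    ... | yes _ = refl
    ... | no ¬p = contradiction refl ¬p
    merge-≢ : ∀ {x} (χb≢x : χ b ≢ x) → merge x ≡ punchOut χb≢x
    merge-≢ {x} χb≢x with χ b Finₚ.≟ x
    ... | yes eq = contradiction eq χb≢x
    ... | no _   = Finₚ.punchOut-cong (χ b) refl
    surjective : ∀ y → ∃[ x ] merge (χ x) ≡ y
    surjective y with surj (punchIn (χ b) y)
    ... | x , eq = x , trans (cong merge eq)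
      (trans (merge-≢ (Finₚ.punchInᵢ≢i (χ b) y ∘ sym)) (Finₚ.punchOut-punchIn (χ b)))
    respects′ : Respects (merge ∘ χ) ((a , b) ∷ L)
    respects′ (here refl) = trans (merge-≢ (χa≢χb ∘ sym)) (sym merge-b)
    respects′ (there e)   = cong merge (respects e)

  -- A surjective colouring with `c` colours and `n + 1 ≤ length L + c` is constant here, so
  -- `c ≤ 1`. Connectivity is expressed through colourings because these become potentials later.
  connected-length : ∀ {n} (L : List (Fin (suc n) × Fin (suc n))) →
    (∀ {c} (χ : Fin (suc n) → Fin c) → Respects χ L → ∀ i → χ i ≡ χ zero) → n ≤ length L
  connected-length {n} L connected with colouring L
  ... | c , χ , surj , respects , n< = ℕₚ.≤-pred (begin
      suc n            ≤⟨ n< ⟩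
      length L + c     ≤⟨ ℕₚ.+-monoʳ-≤ (length L) (few surj (connected χ respects)) ⟩
      length L + 1     ≡⟨ ℕₚ.+-comm (length L) 1 ⟩
      suc (length L)   ∎)
    where
    open ℕₚ.≤-Reasoning
    few : ∀ {c} {χ : Fin (suc n) → Fin c} → (∀ y → ∃[ x ] χ x ≡ y) → (∀ i → χ i ≡ χ zero) → c ≤ 1
    few {zero}        surj const = z≤n
    few {suc zero}    surj const = s≤s z≤n
    few {suc (suc c)} surj const with surj zero | surj (suc zero)
    ... | x , eq | y , eq′ with trans (sym eq) (trans (const x) (trans (sym (const y)) eq′))
    ... | ()

open Counting

-- Residues and the cyclic successor

module Residues where
  open import Data.Nat.Base using (_≤_; _<_; _+_; _*_; _/_; _%_; s≤s; NonZero)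

  %-≡⇒∣ : ∀ m c n .{{_ : NonZero n}} → (m + c) % n ≡ m % n → n ∣ c
  %-≡⇒∣ m c n eq = ∣m+n∣m⇒∣n {m = m / n * n} (divides ((m + c) / n) (ℕₚ.+-cancelˡ-≡ (m % n) _ _ (begin
      m % n + (m / n * n + c)               ≡⟨ ℕₚ.+-assoc (m % n) (m / n * n) c ⟨
      m % n + m / n * n + c                 ≡⟨ cong (_+ c) (m≡m%n+[m/n]*n m n) ⟨
      m + c                                 ≡⟨ m≡m%n+[m/n]*n (m + c) n ⟩
      (m + c) % n + (m + c) / n * n         ≡⟨ cong (_+ (m + c) / n * n) eq ⟩
      m % n + (m + c) / n * n               ∎))) (n∣m*n (m / n))
    where open ≡-Reasoning

  toℕ-mod : ∀ m n .{{_ : NonZero n}} → toℕ (m mod n) ≡ m % n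
  toℕ-mod m n = Finₚ.toℕ-fromℕ< (m%n<n m n)

  mod-cong : ∀ m m′ n .{{_ : NonZero n}} → m % n ≡ m′ % n → m mod n ≡ m′ mod n
  mod-cong m m′ n eq = Finₚ.toℕ-injective (trans (toℕ-mod m n) (trans eq (sym (toℕ-mod m′ n))))

  mod-≡⇒∣ : ∀ m c n .{{_ : NonZero n}} → (m + c) mod n ≡ m mod n → n ∣ c
  mod-≡⇒∣ m c n eq = %-≡⇒∣ m c n (trans (sym (toℕ-mod (m + c) n)) (trans (cong toℕ eq) (toℕ-mod m n)))

  next : ∀ {n} → Fin (suc n) → Fin (suc n)
  next {n} i = suc (toℕ i) mod suc n

  next-inject₁ : ∀ {n} (i : Fin n) → next (inject₁ i) ≡ suc i
  next-inject₁ {n} i = Finₚ.toℕ-injective (trans (toℕ-mod (suc (toℕ (inject₁ i))) (suc n))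
    (trans (cong (λ a → suc a % suc n) (Finₚ.toℕ-inject₁ i)) (m<n⇒m%n≡m (s≤s (Finₚ.toℕ<n i)))))

open Residues

-- Transpositions

module Transposition {V : Set} (_≟_ : DecidableEquality V) where

  transpose : V → V → V → V
  transpose u v x with x ≟ u
  ... | yes _ = v
  ... | no  _ with x ≟ v
  ...   | yes _ = u
  ...   | no  _ = x

  transpose-left : ∀ u v → transpose u v u ≡ v
  transpose-left u v with u ≟ u
  ... | yes _   = refl
  ... | no  u≢u = contradiction refl u≢u

  transpose-right : ∀ u v → transpose u v v ≡ u
  transpose-right u v with v ≟ u
  ... | yes v≡u = v≡u
  ... | no  _ with v ≟ v
  ...   | yes _   = refl
  ...   | no  v≢v = contradiction refl v≢v

  transpose-other : ∀ {u v x} → x ≢ u → x ≢ v → transpose u v x ≡ x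
  transpose-other {u} {v} {x} x≢u x≢v with x ≟ u
  ... | yes x≡u = contradiction x≡u x≢u
  ... | no  _ with x ≟ v
  ...   | yes x≡v = contradiction x≡v x≢v
  ...   | no  _   = refl

  data Position (u v : V) : V → Set where
    left  : Position u v u
    right : Position u v v
    other : ∀ {x} → x ≢ u → x ≢ v → Position u v x

  position : ∀ u v x → Position u v x
  position u v x with x ≟ u
  ... | yes refl = left
  ... | no x≢u with x ≟ v
  ...   | yes refl = right
  ...   | no x≢v   = other x≢u x≢v

  transpose-comm : ∀ u v x → transpose u v x ≡ transpose v u x
  transpose-comm u v x with position u v x
  ... | left        = trans (transpose-left u v) (sym (transpose-right v u))
  ... | right       = trans (transpose-right u v) (sym (transpose-left v u))
  ... | other x≢u x≢v = trans (transpose-other x≢u x≢v) (sym (transpose-other x≢v x≢u))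

  transpose-involutive : ∀ u v x → transpose u v (transpose u v x) ≡ x
  transpose-involutive u v x with position u v x
  ... | left        = trans (cong (transpose u v) (transpose-left u v)) (transpose-right u v)
  ... | right       = trans (cong (transpose u v) (transpose-right u v)) (transpose-left u v)
  ... | other x≢u x≢v =
    trans (cong (transpose u v) (transpose-other x≢u x≢v)) (transpose-other x≢u x≢v)

  transpose-injective : ∀ u v → Injective _≡_ _≡_ (transpose u v)
  transpose-injective u v {x} {y} eq = begin
    x                                 ≡⟨ transpose-involutive u v x ⟨
    transpose u v (transpose u v x)   ≡⟨ cong (transpose u v) eq ⟩
    transpose u v (transpose u v y)   ≡⟨ transpose-involutive u v y ⟩
    y                                 ∎ where open ≡-Reasoning

  -- Conjugation carries the transposition of two positions to that of their images; this moves an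
  -- interchange of tokens past a swap.
  transpose-conjugate : ∀ {g : V → V} → Injective _≡_ _≡_ g → ∀ x y z →
                        transpose (g x) (g y) (g z) ≡ g (transpose x y z)
  transpose-conjugate {g} inj x y z with position x y z
  ... | left        = trans (transpose-left (g x) (g y)) (cong g (sym (transpose-left x y)))
  ... | right       = trans (transpose-right (g x) (g y)) (cong g (sym (transpose-right x y)))
  ... | other z≢x z≢y =
    trans (transpose-other (z≢x ∘ inj) (z≢y ∘ inj)) (cong g (sym (transpose-other z≢x z≢y)))

-- Swap sequences and meetings of tokens

module SwapSequences {V E : Set} (_≟_ : DecidableEquality V) (_≟ᵉ_ : DecidableEquality E)
                     (src tgt : E → V) (src≢tgt : ∀ e → src e ≢ tgt e) where

  open import Data.Nat.Base using (_≤_; _<_; _+_; z≤n; s≤s)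
  open import Data.Integer.Base using (+_; 0ℤ; 1ℤ; -1ℤ)

  open Transposition _≟_ public

  swap : E → V → V
  swap e = transpose (src e) (tgt e)

  -- A token is named by the vertex it starts on, so `run es x` is where the token from `x` ends.
  run : List E → V → V
  run []       x = x
  run (e ∷ es) x = run es (swap e x)

  run-++ : ∀ ds es x → run (ds ++ es) x ≡ run es (run ds x)
  run-++ []       es x = refl
  run-++ (d ∷ ds) es x = run-++ ds es (swap d x)

  swap-involutive : ∀ e x → swap e (swap e x) ≡ x
  swap-involutive e = transpose-involutive (src e) (tgt e)

  swap-injective : ∀ e → Injective _≡_ _≡_ (swap e)
  swap-injective e = transpose-injective (src e) (tgt e)

  run-injective : ∀ es → Injective _≡_ _≡_ (run es)
  run-injective []       eq = eq
  run-injective (e ∷ es) eq = swap-injective e (run-injective es eq)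

  Exchanges : V → V → E → Set
  Exchanges x y e = (x ≡ src e × y ≡ tgt e) ⊎ (x ≡ tgt e × y ≡ src e)

  exchanges? : ∀ x y e → Dec (Exchanges x y e)
  exchanges? x y e =
    ((x ≟ src e) ×-dec (y ≟ tgt e)) ⊎-dec ((x ≟ tgt e) ×-dec (y ≟ src e))

  indicator : ∀ {P : Set} → Dec P → ℕ
  indicator (yes _) = 1
  indicator (no  _) = 0

  meetings : V → V → List E → ℕ
  meetings x y []       = 0
  meetings x y (e ∷ es) = indicator (exchanges? x y e) + meetings (swap e x) (swap e y) es

  exchanges-swap : ∀ {x y e} → Exchanges x y e → swap e x ≡ y × swap e y ≡ x
  exchanges-swap {e = e} (inj₁ (refl , refl)) = transpose-left _ _ , transpose-right _ _
  exchanges-swap {e = e} (inj₂ (refl , refl)) = transpose-right _ _ , transpose-left _ _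

  exchanges-transpose : ∀ {x y e} → Exchanges x y e → ∀ z → swap e z ≡ transpose x y z
  exchanges-transpose (inj₁ (refl , refl)) z = refl
  exchanges-transpose (inj₂ (refl , refl)) z = transpose-comm _ _ z

  -- Once their first meeting is skipped, the two tokens follow each other's trajectories, as if
  -- they had been interchanged at the start.
  drop-meeting : ∀ {P : Pred E 0ℓ} {x y} es → All P es → 1 ≤ meetings x y es →
    ∃[ es′ ] suc (length es′) ≡ length es × All P es′ ×
      (∀ z → run es′ z ≡ run es (transpose x y z))
  drop-meeting {x = x} {y} (e ∷ es) (p ∷ ps) met with exchanges? x y e
  ... | yes ex = es , refl , ps , λ z → cong (run es) (sym (begin
          swap e (transpose x y z)          ≡⟨ exchanges-transpose ex _ ⟩
          transpose x y (transpose x y z)   ≡⟨ transpose-involutive x y z ⟩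
          z                                 ∎))
        where open ≡-Reasoning
  ... | no _ with drop-meeting es ps met
  ...   | es′ , len , ps′ , same = e ∷ es′ , cong suc len , p ∷ ps′ , λ z →
          trans (same (swap e z)) (cong (run es) (transpose-conjugate (swap-injective e) x y z))

  -- If two tokens meet twice, skipping both swaps merely interchanges them in between.
  drop-two-meetings : ∀ {P : Pred E 0ℓ} {x y} es → All P es → 2 ≤ meetings x y es →
    ∃[ es′ ] length es′ < length es × All P es′ × (∀ z → run es′ z ≡ run es z)
  drop-two-meetings {x = x} {y} (e ∷ es) (p ∷ ps) met with exchanges? x y e
  ... | no _ with drop-two-meetings es ps met
  ...   | es′ , len , ps′ , same = e ∷ es′ , s≤s len , p ∷ ps′ , λ z → same (swap e z)
  drop-two-meetings {x = x} {y} (e ∷ es) (p ∷ ps) (s≤s met) | yes ex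
    with drop-meeting es ps met
  ... | es′ , len , ps′ , same =
          es′ , ℕₚ.≤-trans (ℕₚ.≤-reflexive len) (ℕₚ.n≤1+n _) , ps′ , λ z →
          trans (same z) (cong (run es) (begin
            transpose (swap e x) (swap e y) z
              ≡⟨ cong₂ (λ a b → transpose a b z) (proj₁ (exchanges-swap ex)) (proj₂ (exchanges-swap ex)) ⟩
            transpose y x z   ≡⟨ transpose-comm y x z ⟩
            transpose x y z   ≡⟨ exchanges-transpose ex z ⟨
            swap e z          ∎))
        where open ≡-Reasoning

  -- Line integrals of 1-cochains along token trajectories

  sign : E → V → ℤ
  sign e x with x ≟ src e
  ... | yes _ = 1ℤ
  ... | no  _ with x ≟ tgt e
  ...   | yes _ = -1ℤ
  ...   | no  _ = 0ℤ

  sign-src : ∀ e → sign e (src e) ≡ 1ℤ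
  sign-src e with src e ≟ src e
  ... | yes _ = refl
  ... | no ¬p = contradiction refl ¬p

  sign-tgt : ∀ e → sign e (tgt e) ≡ -1ℤ
  sign-tgt e with tgt e ≟ src e
  ... | yes p = contradiction (sym p) (src≢tgt e)
  ... | no _ with tgt e ≟ tgt e
  ...   | yes _ = refl
  ...   | no ¬p = contradiction refl ¬p

  sign-other : ∀ {e x} → x ≢ src e → x ≢ tgt e → sign e x ≡ 0ℤ
  sign-other {e} {x} x≢s x≢t with x ≟ src e
  ... | yes p = contradiction p x≢s
  ... | no _ with x ≟ tgt e
  ...   | yes p = contradiction p x≢t
  ...   | no _ = refl

  -- The line integral of the 1-cochain ω along the trajectory of the token on x.
  ∫ : (E → ℤ) → List E → V → ℤ
  ∫ ω []       x = 0ℤ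
  ∫ ω (e ∷ es) x = sign e x ℤ.* ω e ℤ.+ ∫ ω es (swap e x)

  -- The coboundary of a 0-cochain, with edges oriented from `src` to `tgt`.
  d : (V → ℤ) → E → ℤ
  d φ e = φ (tgt e) ℤ.- φ (src e)

  δ : E → E → ℤ
  δ e e′ with e ≟ᵉ e′
  ... | yes _ = 1ℤ
  ... | no  _ = 0ℤ

  -- The net number of traversals of `e` by the token, counted positively from `src e` to `tgt e`.
  flow : E → List E → V → ℤ
  flow e = ∫ (δ e)

  -- Each swap changes the potential at the token by exactly its term of the integral; the changes
  -- telescope.
  stokes : ∀ φ es x → φ (run es x) ≡ φ x ℤ.+ ∫ (d φ) es x
  stokes φ []       x = sym (ℤₚ.+-identityʳ (φ x))
  stokes φ (e ∷ es) x = begin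
    φ (run es (swap e x))                                ≡⟨ stokes φ es (swap e x) ⟩
    φ (swap e x) ℤ.+ rest                                ≡⟨ cong (ℤ._+ rest) (step (position _ _ x)) ⟩
    φ x ℤ.+ sign e x ℤ.* d φ e ℤ.+ rest                  ≡⟨ ℤₚ.+-assoc (φ x) _ rest ⟩
    φ x ℤ.+ (sign e x ℤ.* d φ e ℤ.+ rest)                ∎
    where
    open ≡-Reasoning
    rest = ∫ (d φ) es (swap e x)
    forth : ∀ a b → b ≡ a ℤ.+ 1ℤ ℤ.* (b ℤ.- a)
    forth = ℤ-Solver.solve-∀
    back : ∀ a b → a ≡ b ℤ.+ -1ℤ ℤ.* (b ℤ.- a)
    back = ℤ-Solver.solve-∀
    stay : ∀ a b → a ≡ a ℤ.+ 0ℤ ℤ.* b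
    stay = ℤ-Solver.solve-∀
    step : ∀ {x} → Position (src e) (tgt e) x → φ (swap e x) ≡ φ x ℤ.+ sign e x ℤ.* d φ e
    step left  rewrite transpose-left (src e) (tgt e) | sign-src e = forth (φ (src e)) (φ (tgt e))
    step right rewrite transpose-right (src e) (tgt e) | sign-tgt e = back (φ (src e)) (φ (tgt e))
    step {x} (other x≢s x≢t)
      rewrite transpose-other x≢s x≢t | sign-other {e} x≢s x≢t = stay (φ x) (d φ e)

  ∫-cong : ∀ {ω ω′} → (∀ e → ω e ≡ ω′ e) → ∀ es x → ∫ ω es x ≡ ∫ ω′ es x
  ∫-cong eq []       x = refl
  ∫-cong eq (e ∷ es) x = cong₂ (λ a b → sign e x ℤ.* a ℤ.+ b) (eq e) (∫-cong eq es (swap e x))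

  ∫-linear : ∀ ω c ω′ es x →
             ∫ (λ e → ω e ℤ.+ c ℤ.* ω′ e) es x ≡ ∫ ω es x ℤ.+ c ℤ.* ∫ ω′ es x
  ∫-linear ω c ω′ []       x = lemma c
    where lemma : ∀ a → 0ℤ ≡ 0ℤ ℤ.+ a ℤ.* 0ℤ
          lemma = ℤ-Solver.solve-∀
  ∫-linear ω c ω′ (e ∷ es) x
    rewrite ∫-linear ω c ω′ es (swap e x) = lemma (sign e x) (ω e) c (ω′ e) _ _
    where
    lemma : ∀ s a c b p q → s ℤ.* (a ℤ.+ c ℤ.* b) ℤ.+ (p ℤ.+ c ℤ.* q)
                          ≡ s ℤ.* a ℤ.+ p ℤ.+ c ℤ.* (s ℤ.* b ℤ.+ q)
    lemma = ℤ-Solver.solve-∀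

  ∫-zero : ∀ {ω} es → (∀ e → e ∈ es → ω e ≡ 0ℤ) → ∀ x → ∫ ω es x ≡ 0ℤ
  ∫-zero []       ω≡0 x = refl
  ∫-zero {ω} (e ∷ es) ω≡0 x
    rewrite ω≡0 e (here refl) | ∫-zero {ω} es (λ e′ → ω≡0 e′ ∘ there) (swap e x) =
    lemma (sign e x)
    where lemma : ∀ a → a ℤ.* 0ℤ ℤ.+ 0ℤ ≡ 0ℤ
          lemma = ℤ-Solver.solve-∀

  -- The integral is the sum of `ω e` times the flow through `e` over the finitely many edges
  -- occurring in `es`, and every summand vanishes.
  ∫-zero-flow : ∀ {ω} es x → (∀ e → ω e ℤ.* flow e es x ≡ 0ℤ) → ∫ ω es x ≡ 0ℤ
  ∫-zero-flow es x = strip es (λ _ → inj₁)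
    where
    -- `F` contains the edges of `es` at which `ω` may still be nonzero; each step splits off one
    -- multiple of `δ f`.
    strip : ∀ F {ω} → (∀ e → e ∈ es → e ∈ F ⊎ ω e ≡ 0ℤ) →
            (∀ e → ω e ℤ.* flow e es x ≡ 0ℤ) → ∫ ω es x ≡ 0ℤ
    strip [] supp _ = ∫-zero es (λ e e∈ → fromInj₂ (λ ()) (supp e e∈)) x
    strip (f ∷ F) {ω} supp null = begin
      ∫ ω es x                                  ≡⟨ ∫-cong split es x ⟩
      ∫ (λ e → ω′ e ℤ.+ ω f ℤ.* δ f e) es x     ≡⟨ ∫-linear ω′ (ω f) (δ f) es x ⟩
      ∫ ω′ es x ℤ.+ ω f ℤ.* flow f es x         ≡⟨ cong₂ ℤ._+_ (strip F supp′ null′) (null f) ⟩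
      0ℤ                                        ∎
      where
      open ≡-Reasoning
      ω′ : E → ℤ
      ω′ e with f ≟ᵉ e
      ... | yes _ = 0ℤ
      ... | no  _ = ω e
      split : ∀ e → ω e ≡ ω′ e ℤ.+ ω f ℤ.* δ f e
      split e with f ≟ᵉ e
      ... | yes refl = lemma (ω f)
        where lemma : ∀ a → a ≡ 0ℤ ℤ.+ a ℤ.* 1ℤ
              lemma = ℤ-Solver.solve-∀
      ... | no  _    = lemma (ω e) (ω f)
        where lemma : ∀ a b → a ≡ a ℤ.+ b ℤ.* 0ℤ
              lemma = ℤ-Solver.solve-∀
      supp′ : ∀ e → e ∈ es → e ∈ F ⊎ ω′ e ≡ 0ℤ
      supp′ e e∈ with f ≟ᵉ e | supp e e∈
      ... | yes _  | _                   = inj₂ refl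
      ... | no _   | inj₂ z              = inj₂ z
      ... | no f≢e | inj₁ (here e≡f)     = contradiction (sym e≡f) f≢e
      ... | no _   | inj₁ (there e∈F)    = inj₁ e∈F
      null′ : ∀ e → ω′ e ℤ.* flow e es x ≡ 0ℤ
      null′ e with f ≟ᵉ e
      ... | yes _ = refl
      ... | no  _ = null e

  -- Counting the swaps in which a token takes part

  moves : List E → V → List E
  moves []       x = []
  moves (e ∷ es) x with position (src e) (tgt e) x
  ... | other _ _ = moves es (swap e x)
  ... | _         = e ∷ moves es (swap e x)

  flow-drop : ∀ {e} e′ es x → sign e′ x ℤ.* δ e e′ ≡ 0ℤ →
              flow e (e′ ∷ es) x ≡ flow e es (swap e′ x)
  flow-drop {e} e′ es x eq = trans (cong (ℤ._+ flow e es (swap e′ x)) eq) (ℤₚ.+-identityˡ _)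

  δ-off : ∀ {e e′} → e ≢ e′ → δ e e′ ≡ 0ℤ
  δ-off {e} {e′} e≢e′ with e ≟ᵉ e′
  ... | yes e≡e′ = contradiction e≡e′ e≢e′
  ... | no  _    = refl

  here-or-there : ∀ {a e e′ fs} → Dec (e ≡ e′) → (a ℤ.* δ e e′ ≡ 0ℤ → e ∈ fs) → e ∈ e′ ∷ fs
  here-or-there     (yes e≡e′) _     = here e≡e′
  here-or-there {a} (no e≢e′)  later = there (later (trans (cong (a ℤ.*_) (δ-off e≢e′)) (ℤₚ.*-zeroʳ a)))

  -- Swaps that leave the token alone or use another edge contribute zero to the flow.
  flow≢0⇒∈moves : ∀ {e} es x → flow e es x ≢ 0ℤ → e ∈ moves es x
  flow≢0⇒∈moves []       x nz = contradiction refl nz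
  flow≢0⇒∈moves {e} (e′ ∷ es) x nz
    with position (src e′) (tgt e′) x | flow≢0⇒∈moves {e} es (swap e′ x)
       | flow-drop {e} e′ es x | sign-other {e′} {x}
  ... | other x≢s x≢t | ih | drop | off = ih (nz ∘ trans (drop (cong (ℤ._* δ e e′) (off x≢s x≢t))))
  ... | left          | ih | drop | _   = here-or-there {sign e′ (src e′)} (e ≟ᵉ e′) (λ z → ih (nz ∘ trans (drop z)))
  ... | right         | ih | drop | _   = here-or-there {sign e′ (tgt e′)} (e ≟ᵉ e′) (λ z → ih (nz ∘ trans (drop z)))

  moves⊆ : ∀ {e} es x → e ∈ moves es x → e ∈ es
  moves⊆ (e′ ∷ es) x e∈ with position (src e′) (tgt e′) x
  moves⊆ (e′ ∷ es) x (here e≡)  | left      = here e≡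
  moves⊆ (e′ ∷ es) x (there e∈) | left      = there (moves⊆ es _ e∈)
  moves⊆ (e′ ∷ es) x (here e≡)  | right     = here e≡
  moves⊆ (e′ ∷ es) x (there e∈) | right     = there (moves⊆ es _ e∈)
  moves⊆ (e′ ∷ es) x e∈         | other _ _ = there (moves⊆ es _ e∈)

  indicator≤1 : ∀ {P : Set} (P? : Dec P) → indicator P? ≤ 1
  indicator≤1 (yes _) = s≤s z≤n
  indicator≤1 (no  _) = z≤n

  module _ {P : Pred E 0ℓ} (P? : Decidable P) where

    count : List E → ℕ
    count es = length (filter P? es)

    count-∷ : ∀ e es → count (e ∷ es) ≡ indicator (P? e) + count es
    count-∷ e es with P? e
    ... | yes _ = refl
    ... | no  _ = refl

    moved : E → V → ℕ
    moved e x with position (src e) (tgt e) x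
    ... | other _ _ = 0
    ... | _         = indicator (P? e)

    count-moves-∷ : ∀ e es x →
      count (moves (e ∷ es) x) ≡ moved e x + count (moves es (swap e x))
    count-moves-∷ e es x with position (src e) (tgt e) x
    ... | left      = count-∷ e _
    ... | right     = count-∷ e _
    ... | other _ _ = refl

    -- A swap that moves two distinct tokens exchanges them, so counting it twice is paid for by a
    -- meeting.
    moved-twice : ∀ {x y} → x ≢ y → ∀ e →
      moved e x + moved e y ≤ indicator (P? e) + indicator (exchanges? x y e)
    moved-twice {x} {y} x≢y e
      with position (src e) (tgt e) x | position (src e) (tgt e) y | exchanges? x y e
    ... | left      | left      | _      = contradiction refl x≢y
    ... | right     | right     | _      = contradiction refl x≢y
    ... | left      | right     | yes _  = ℕₚ.+-monoʳ-≤ (indicator (P? e)) (indicator≤1 (P? e))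
    ... | left      | right     | no ¬ex = contradiction (inj₁ (refl , refl)) ¬ex
    ... | right     | left      | yes _  = ℕₚ.+-monoʳ-≤ (indicator (P? e)) (indicator≤1 (P? e))
    ... | right     | left      | no ¬ex = contradiction (inj₂ (refl , refl)) ¬ex
    ... | left      | other _ _ | _      = ℕₚ.+-monoʳ-≤ (indicator (P? e)) z≤n
    ... | right     | other _ _ | _      = ℕₚ.+-monoʳ-≤ (indicator (P? e)) z≤n
    ... | other _ _ | left      | _      = ℕₚ.m≤m+n _ _
    ... | other _ _ | right     | _      = ℕₚ.m≤m+n _ _
    ... | other _ _ | other _ _ | _      = z≤n

    count-moves : ∀ {x y} → x ≢ y → ∀ es →
      count (moves es x) + count (moves es y) ≤ count es + meetings x y es
    count-moves x≢y [] = z≤n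
    count-moves {x} {y} x≢y (e ∷ es) = begin
      count (moves (e ∷ es) x) + count (moves (e ∷ es) y)
        ≡⟨ cong₂ _+_ (count-moves-∷ e es x) (count-moves-∷ e es y) ⟩
      moved e x + count (moves es (swap e x)) + (moved e y + count (moves es (swap e y)))
        ≡⟨ interchange (moved e x) _ (moved e y) _ ⟩
      moved e x + moved e y + (count (moves es (swap e x)) + count (moves es (swap e y)))
        ≤⟨ ℕₚ.+-mono-≤ (moved-twice x≢y e) (count-moves (x≢y ∘ swap-injective e) es) ⟩
      indicator (P? e) + indicator (exchanges? x y e) + (count es + meetings (swap e x) (swap e y) es)
        ≡⟨ interchange (indicator (P? e)) _ (count es) _ ⟩
      indicator (P? e) + count es + meetings x y (e ∷ es)
        ≡⟨ cong (_+ meetings x y (e ∷ es)) (count-∷ e es) ⟨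
      count (e ∷ es) + meetings x y (e ∷ es)
        ∎
      where open ℕₚ.≤-Reasoning

  -- Sums over all tokens

  module FiniteVertices {N : ℕ} (finite : V ↔ Fin N) where

    private
      module I = Inverse finite
      open Sum ℤₚ.+-0-commutativeMonoid
        using (sum; sum-remove; sum-permute; ∑-distrib-+; sum-cong-≗; sum-replicate-zero)

      single : ∀ {n} (i : Fin n) f → (∀ j → j ≢ i → f j ≡ 0ℤ) → sum f ≡ f i
      single {suc n} i f zeros = begin
        sum f                        ≡⟨ sum-remove {i = i} f ⟩
        f i ℤ.+ sum (f ∘ punchIn i)  ≡⟨ cong (ℤ._+_ (f i)) (sum-cong-≗ (λ j → zeros (punchIn i j) (Finₚ.punchInᵢ≢i i j))) ⟩
        f i ℤ.+ sum (λ (_ : Fin n) → 0ℤ)  ≡⟨ cong (ℤ._+_ (f i)) (sum-replicate-zero n) ⟩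
        f i ℤ.+ 0ℤ                   ≡⟨ ℤₚ.+-identityʳ (f i) ⟩
        f i                          ∎
        where open ≡-Reasoning

    total : (V → ℤ) → ℤ
    total g = sum (g ∘ I.from)

    total-cong : ∀ {g h : V → ℤ} → (∀ x → g x ≡ h x) → total g ≡ total h
    total-cong {g} {h} eq = sum-cong-≗ {x = g ∘ I.from} {h ∘ I.from} (eq ∘ I.from)

    total-+ : ∀ g h → total (λ x → g x ℤ.+ h x) ≡ total g ℤ.+ total h
    total-+ g h = ∑-distrib-+ (g ∘ I.from) (h ∘ I.from)

    total-swap : ∀ g e → total (g ∘ swap e) ≡ total g
    total-swap g e = begin
      total (g ∘ swap e)                             ≡⟨ total-cong (λ x → cong g (sym (I.strictlyInverseʳ (swap e x)))) ⟩
      sum (g ∘ I.from ∘ (I.to ∘ swap e ∘ I.from))    ≡⟨ sum-permute (g ∘ I.from) π ⟨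
      total g                                        ∎
      where
      open ≡-Reasoning
      inv : ∀ i → I.to (swap e (I.from (I.to (swap e (I.from i))))) ≡ i
      inv i rewrite I.strictlyInverseʳ (swap e (I.from i)) | swap-involutive e (I.from i) =
        I.strictlyInverseˡ i
      π = permutation (I.to ∘ swap e ∘ I.from) (I.to ∘ swap e ∘ I.from) inv inv

    sign-swap : ∀ e x → sign e (swap e x) ≡ ℤ.- sign e x
    sign-swap e x with position (src e) (tgt e) x
    ... | left  rewrite transpose-left (src e) (tgt e) | sign-src e = sign-tgt e
    ... | right rewrite transpose-right (src e) (tgt e) | sign-tgt e = sign-src e
    ... | other x≢s x≢t rewrite transpose-other x≢s x≢t | sign-other {e} x≢s x≢t = refl

    -- Every swap moves one token forth and one token back.
    total-∫ : ∀ ω es → total (∫ ω es) ≡ 0ℤ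
    total-∫ ω []       = sum-replicate-zero N
    total-∫ ω (e ∷ es) = begin
      total (∫ ω (e ∷ es))                     ≡⟨ total-+ g (∫ ω es ∘ swap e) ⟩
      total g ℤ.+ total (∫ ω es ∘ swap e)      ≡⟨ cong₂ ℤ._+_ total-g (trans (total-swap (∫ ω es) e) (total-∫ ω es)) ⟩
      0ℤ                                       ∎
      where
      open ≡-Reasoning
      g = λ x → sign e x ℤ.* ω e
      odd : ∀ x → g x ℤ.+ g (swap e x) ≡ 0ℤ
      odd x rewrite sign-swap e x = lemma (sign e x) (ω e)
        where lemma : ∀ a b → a ℤ.* b ℤ.+ (ℤ.- a) ℤ.* b ≡ 0ℤ
              lemma = ℤ-Solver.solve-∀
      double : total g ℤ.+ total g ≡ 0ℤ
      double = begin
        total g ℤ.+ total g                    ≡⟨ cong (ℤ._+_ (total g)) (total-swap g e) ⟨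
        total g ℤ.+ total (g ∘ swap e)         ≡⟨ total-+ g (g ∘ swap e) ⟨
        total (λ x → g x ℤ.+ g (swap e x))     ≡⟨ total-cong odd ⟩
        total (λ _ → 0ℤ)                       ≡⟨ sum-replicate-zero N ⟩
        0ℤ                                     ∎
      half : ∀ a → a ℤ.+ a ≡ 0ℤ → a ≡ 0ℤ
      half (+ zero)    _ = refl
      half (ℤ.+[1+ n ]) ()
      half (ℤ.-[1+ n ]) ()
      total-g : total g ≡ 0ℤ
      total-g = half (total g) double

    total-single : ∀ g x → (∀ y → y ≢ x → g y ≡ 0ℤ) → total g ≡ g x
    total-single g x others = begin
      total g          ≡⟨ single (I.to x) (g ∘ I.from) (λ j j≢ → others (I.from j) (j≢ ∘ to-x)) ⟩
      g (I.from (I.to x))  ≡⟨ cong g (I.strictlyInverseʳ x) ⟩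
      g x              ∎
      where
      open ≡-Reasoning
      to-x : ∀ {j} → I.from j ≡ x → j ≡ I.to x
      to-x {j} refl = sym (I.strictlyInverseˡ j)

    -- The flows of all tokens through `e` sum to zero, so a nonzero one cannot stand alone.
    another-flow : ∀ e es x → flow e es x ≢ 0ℤ → ∃[ y ] y ≢ x × flow e es y ≢ 0ℤ
    another-flow e es x nz with finite-∃? (N , finite) (λ y → ¬? (y ≟ x) ×-dec ¬? (flow e es y ℤₚ.≟ 0ℤ))
    ... | yes found = found
    ... | no none   = contradiction
          (trans (sym (total-single (flow e es) x vanish)) (total-∫ (δ e) es)) nz
      where
      vanish : ∀ y → y ≢ x → flow e es y ≡ 0ℤ
      vanish y y≢x with flow e es y ℤₚ.≟ 0ℤ
      ... | yes z = z
      ... | no ¬z = contradiction (y , y≢x , ¬z) none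

    -- Each removal of a double meeting shortens the sequence, so the length bounds the number of
    -- removals; `P` survives because the remaining swaps come from `es`.
    meet-at-most-once : ∀ {P : Pred E 0ℓ} es → All P es →
      ∃[ es′ ] length es′ ≤ length es × All P es′ × (∀ z → run es′ z ≡ run es z)
        × (∀ x y → meetings x y es′ ≤ 1)
    meet-at-most-once {P} es ps = go (length es) es ps ℕₚ.≤-refl
      where
      go : ∀ n es → All P es → length es ≤ n →
        ∃[ es′ ] length es′ ≤ length es × All P es′ × (∀ z → run es′ z ≡ run es z)
          × (∀ x y → meetings x y es′ ≤ 1)
      go n es ps len with finite-∃? (N , finite) (λ x → finite-∃? (N , finite) (λ y → 2 ℕₚ.≤? meetings x y es))
      ... | no once = es , ℕₚ.≤-refl , ps , (λ _ → refl) ,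
                      λ x y → ℕₚ.≮⇒≥ (λ met → once (x , y , met))
      go n es ps len | yes (x , y , met) with drop-two-meetings es ps met
      go zero es ps len | yes (x , y , met) | es′ , shorter , _ =
        contradiction (ℕₚ.<-≤-trans shorter len) λ ()
      go (suc n) es ps len | yes (x , y , met) | es′ , shorter , ps′ , same
        with go n es′ ps′ (ℕₚ.≤-pred (ℕₚ.<-≤-trans shorter len))
      ... | es″ , len″ , ps″ , same″ , once =
        es″ , ℕₚ.≤-trans len″ (ℕₚ.<⇒≤ shorter) , ps″ , (λ z → trans (same″ z) (same z)) , once

-- The graph: layers, hub and oriented edges

module Construction (k′ R′ : ℕ) where

  open import Data.Nat.Base using (_≤_; _<_; _+_; _*_; _∸_; z≤n; s≤s)

  -- `ℓ = 2R - 1` inner vertices cut a subdivided edge into `r = 2R` segments, and `s = kR + 1` is 1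
  -- modulo `k`.
  k R s ℓ r : ℕ
  k = suc k′
  R = suc R′
  s = suc (k * R)
  ℓ = suc (R′ + R′)
  r = suc ℓ

  -- Inner vertices are indexed by ordered pairs of ends: two terminals of a layer are joined by one
  -- oriented path in either direction, and each terminal carries a closed path.
  data Vertex : Set where
    centre   : Vertex
    slot     : Fin k → Fin R → Vertex
    terminal : Fin s → Fin k → Vertex
    inner    : Fin s → Fin k → Fin k → Fin ℓ → Vertex

  -- Edges have names and orientations so that cochains can live on them. A `spoke` or `step`
  -- carries the index of its target; a `connector` points from the hub to a layer.
  data Edge : Set where
    spoke     : Fin k → Fin R → Edge
    connector : Fin s → Fin k → Edge
    step      : Fin s → Fin k → Fin k → Fin ℓ → Edge
    exit      : Fin s → Fin k → Fin k → Edge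

  abstract

    finite-Vertex : Finite Vertex
    finite-Vertex = finite-↔ code
      (finite-⊎ (finite-Fin 1)
      (finite-⊎ (finite-× (finite-Fin k) (finite-Fin R))
      (finite-⊎ (finite-× (finite-Fin s) (finite-Fin k))
                (finite-× (finite-Fin s) (finite-× (finite-Fin k) (finite-× (finite-Fin k) (finite-Fin ℓ)))))))
      where
      code : Vertex ↔ (Fin 1 ⊎ (Fin k × Fin R) ⊎ (Fin s × Fin k) ⊎ (Fin s × Fin k × Fin k × Fin ℓ))
      code = mk↔ₛ′
        (λ { centre          → inj₁ zero
           ; (slot i p)      → inj₂ (inj₁ (i , p))
           ; (terminal j i)  → inj₂ (inj₂ (inj₁ (j , i)))
           ; (inner j a b p) → inj₂ (inj₂ (inj₂ (j , a , b , p))) })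
        (λ { (inj₁ zero)                            → centre
           ; (inj₂ (inj₁ (i , p)))                  → slot i p
           ; (inj₂ (inj₂ (inj₁ (j , i))))           → terminal j i
           ; (inj₂ (inj₂ (inj₂ (j , a , b , p))))   → inner j a b p })
        (λ { (inj₁ zero) → refl ; (inj₂ (inj₁ _)) → refl
           ; (inj₂ (inj₂ (inj₁ _))) → refl ; (inj₂ (inj₂ (inj₂ _))) → refl })
        (λ { centre → refl ; (slot _ _) → refl ; (terminal _ _) → refl ; (inner _ _ _ _) → refl })

    finite-Edge : Finite Edge
    finite-Edge = finite-↔ code
      (finite-⊎ (finite-× (finite-Fin k) (finite-Fin R))
      (finite-⊎ (finite-× (finite-Fin s) (finite-Fin k))
      (finite-⊎ (finite-× (finite-Fin s) (finite-× (finite-Fin k) (finite-× (finite-Fin k) (finite-Fin ℓ))))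
                (finite-× (finite-Fin s) (finite-× (finite-Fin k) (finite-Fin k))))))
      where
      code : Edge ↔ ((Fin k × Fin R) ⊎ (Fin s × Fin k) ⊎ (Fin s × Fin k × Fin k × Fin ℓ) ⊎ (Fin s × Fin k × Fin k))
      code = mk↔ₛ′
        (λ { (spoke i p)     → inj₁ (i , p)
           ; (connector j i) → inj₂ (inj₁ (j , i))
           ; (step j a b p)  → inj₂ (inj₂ (inj₁ (j , a , b , p)))
           ; (exit j a b)    → inj₂ (inj₂ (inj₂ (j , a , b))) })
        (λ { (inj₁ (i , p))                        → spoke i p
           ; (inj₂ (inj₁ (j , i)))                 → connector j i
           ; (inj₂ (inj₂ (inj₁ (j , a , b , p))))  → step j a b p
           ; (inj₂ (inj₂ (inj₂ (j , a , b))))      → exit j a b })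
        (λ { (inj₁ _) → refl ; (inj₂ (inj₁ _)) → refl
           ; (inj₂ (inj₂ (inj₁ _))) → refl ; (inj₂ (inj₂ (inj₂ _))) → refl })
        (λ { (spoke _ _) → refl ; (connector _ _) → refl ; (step _ _ _ _) → refl ; (exit _ _ _) → refl })

  _≟ᵉ_ : DecidableEquality Edge
  _≟ᵉ_ = Finₚ.inj⇒≟ (↔⇒↣ (proj₂ finite-Edge))

  last : Fin R
  last = fromℕ R′

  hubNode : Fin k → Fin (suc R) → Vertex
  hubNode i zero    = centre
  hubNode i (suc p) = slot i p

  pathNode : Fin s → Fin k → Fin k → Fin (suc ℓ) → Vertex
  pathNode j a b zero    = terminal j a
  pathNode j a b (suc p) = inner j a b p

  src tgt : Edge → Vertex
  src (spoke i p)     = hubNode i (inject₁ p)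
  src (connector j i) = slot i last
  src (step j a b p)  = pathNode j a b (inject₁ p)
  src (exit j a b)    = inner j a b (fromℕ _)
  tgt (spoke i p)     = slot i p
  tgt (connector j i) = terminal j i
  tgt (step j a b p)  = inner j a b p
  tgt (exit j a b)    = terminal j b

  inject₁≢suc : ∀ {n} (p : Fin n) → inject₁ p ≢ suc p
  inject₁≢suc p eq = ℕₚ.1+n≢n (sym (trans (sym (Finₚ.toℕ-inject₁ p)) (cong toℕ eq)))

  slot-injective : ∀ {i i′ p p′} → slot i p ≡ slot i′ p′ → i ≡ i′ × p ≡ p′
  slot-injective refl = refl , refl

  terminal-injective : ∀ {j j′ i i′} → terminal j i ≡ terminal j′ i′ → j ≡ j′ × i ≡ i′
  terminal-injective refl = refl , refl

  inner-injective : ∀ {j j′ a a′ b b′ p p′} → inner j a b p ≡ inner j′ a′ b′ p′ →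
                    j ≡ j′ × a ≡ a′ × b ≡ b′ × p ≡ p′
  inner-injective refl = refl , refl , refl , refl

  src≢tgt : ∀ e → src e ≢ tgt e
  src≢tgt (spoke i zero)       ()
  src≢tgt (spoke i (suc p))    eq = inject₁≢suc p (proj₂ (slot-injective eq))
  src≢tgt (step j a b (suc p)) eq with inner-injective eq
  ... | _ , _ , _ , p≡ = inject₁≢suc p p≡

  Joins : Vertex → Vertex → Edge → Set
  Joins u v e = (src e ≡ u × tgt e ≡ v) ⊎ (src e ≡ v × tgt e ≡ u)

  _≟_ : DecidableEquality Vertex
  _≟_ = Finₚ.inj⇒≟ (↔⇒↣ (proj₂ finite-Vertex))

  joins? : ∀ u v → Decidable (Joins u v)
  joins? u v e = ((src e ≟ u) ×-dec (tgt e ≟ v)) ⊎-dec ((src e ≟ v) ×-dec (tgt e ≟ u))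

  graph : Graph
  graph = record
    { Vertex   = Vertex
    ; order    = proj₁ finite-Vertex
    ; finite   = proj₂ finite-Vertex
    ; Adj      = λ u v → ∃[ e ] Joins u v e
    ; adj?     = λ u v → finite-∃? finite-Edge (joins? u v)
    ; symm     = λ { (e , inj₁ eqs) → e , inj₂ eqs ; (e , inj₂ eqs) → e , inj₁ eqs }
    ; loopless = λ { refl (e , inj₁ (s≡ , t≡)) → src≢tgt e (trans s≡ (sym t≡))
                   ; refl (e , inj₂ (s≡ , t≡)) → src≢tgt e (trans s≡ (sym t≡)) }
    }

  -- Walks, ports and distances across pieces

  open Graph graph using (Adj; symm; Walk; nil; cons; IsDistance; MovesFurther)

  forward : ∀ e → Adj (src e) (tgt e)
  forward e = e , inj₁ (refl , refl)

  snoc : ∀ {u v w n} → Walk u v n → Adj v w → Walk u w (suc n)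
  snoc nil        a = cons a nil
  snoc (cons b w) a = cons b (snoc w a)

  reverse-walk : ∀ {u v n} → Walk u v n → Walk v u n
  reverse-walk nil        = nil
  reverse-walk (cons a w) = snoc (reverse-walk w) (symm a)

  infixr 5 _++ʷ_
  _++ʷ_ : ∀ {u v w m n} → Walk u v m → Walk v w n → Walk u w (m + n)
  nil      ++ʷ w′ = w′
  cons a w ++ʷ w′ = cons a (w ++ʷ w′)

  along-hub : ∀ i p → Walk centre (hubNode i p) (toℕ p)
  along-hub i = <-weakInduction _ nil λ p w →
    subst (Walk centre (slot i p)) (cong suc (Finₚ.toℕ-inject₁ p)) (snoc w (forward (spoke i p)))

  along-path : ∀ j a b p → Walk (terminal j a) (pathNode j a b p) (toℕ p)
  along-path j a b = <-weakInduction _ nil λ p w →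
    subst (Walk (terminal j a) (inner j a b p)) (cong suc (Finₚ.toℕ-inject₁ p))
      (snoc w (forward (step j a b p)))

  -- The hub is the piece nothing and the layer j is the piece just j.
  Piece : Set
  Piece = Maybe (Fin s)

  piece : Vertex → Piece
  piece centre          = nothing
  piece (slot _ _)      = nothing
  piece (terminal j _)  = just j
  piece (inner j _ _ _) = just j

  _≟ᵖ_ : DecidableEquality Piece
  _≟ᵖ_ = Maybeₚ.≡-dec Finₚ._≟_

  -- The places where a piece can be left: every edge between two pieces joins ports of equal index.
  data Port (i : Fin k) : Vertex → Set where
    hub-port   : Port i (slot i last)
    layer-port : ∀ j → Port i (terminal j i)

  portGap : Fin k → Fin k → ℕ
  portGap a i with a Finₚ.≟ i
  ... | yes _ = 0
  ... | no  _ = r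

  -- Between distinct ports both kinds of piece offer a route of length `r`: `R + R` through the
  -- centre, `ℓ + 1` along a subdivided edge.
  port-walk : ∀ {a i u v} → Port a u → Port i v → piece u ≡ piece v →
              ∃[ n ] Walk u v n × n ≤ portGap a i
  port-walk {a} {i} pu pv same with a Finₚ.≟ i
  port-walk {a} hub-port       hub-port        _    | yes refl = 0 , nil , z≤n
  port-walk {a} (layer-port j) (layer-port .j) refl | yes refl = 0 , nil , z≤n
  port-walk {a} {i} hub-port       hub-port        _    | no _ =
    _ , reverse-walk (along-hub a (suc last)) ++ʷ along-hub i (suc last) ,
    ℕₚ.≤-reflexive (trans (cong₂ (λ m n → suc m + suc n) (Finₚ.toℕ-fromℕ R′) (Finₚ.toℕ-fromℕ R′))
                          (cong suc (ℕₚ.+-suc R′ R′)))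
  port-walk {a} {i} (layer-port j) (layer-port .j) refl | no _ =
    _ , snoc (along-path j a i (fromℕ _)) (forward (exit j a i)) ,
    ℕₚ.≤-reflexive (cong suc (Finₚ.toℕ-fromℕ ℓ))

  -- A 1-Lipschitz lower bound for the distance between v and the i-th port of its piece.
  gap : Vertex → Fin k → ℕ
  gap centre i = R
  gap (slot a p) i with a Finₚ.≟ i
  ... | yes _ = R′ ∸ toℕ p
  ... | no  _ = suc (R + toℕ p)
  gap (terminal j a) i = portGap a i
  gap (inner j a b p) i with a Finₚ.≟ i | b Finₚ.≟ i
  ... | yes _ | yes _ = 0
  ... | yes _ | no  _ = suc (toℕ p)
  ... | no  _ | yes _ = ℓ ∸ toℕ p
  ... | no  _ | no  _ = r

  Near : ℕ → ℕ → Set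
  Near m n = m ≤ suc n × n ≤ suc m

  near-refl : ∀ {n} → Near n n
  near-refl = ℕₚ.n≤1+n _ , ℕₚ.n≤1+n _

  near-suc : ∀ {m n} → suc m ≡ n → Near m n
  near-suc refl = ℕₚ.m≤n⇒m≤1+n (ℕₚ.n≤1+n _) , ℕₚ.≤-refl

  near-sym : ∀ {m n} → Near m n → Near n m
  near-sym (p , q) = q , p

  near-∸ : ∀ n p → Near (n ∸ p) (n ∸ suc p)
  near-∸ zero    zero    = near-refl
  near-∸ (suc n) zero    = near-sym (near-suc refl)
  near-∸ zero    (suc p) = near-refl
  near-∸ (suc n) (suc p) = near-∸ n p

  near-inject₁ : ∀ {n} (p : Fin n) (f : ℕ → ℕ) → Near (f (toℕ p)) (f (suc (toℕ p))) →
                 Near (f (toℕ (inject₁ p))) (f (suc (toℕ p)))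
  near-inject₁ p f = subst (λ m → Near (f m) (f (suc (toℕ p)))) (sym (Finₚ.toℕ-inject₁ p))

  -- The connectors are where the lengths matter: their ends both have gap 0 or both have gap `r`,
  -- because the way through the centre is as long as a subdivided edge.
  gap-Lipschitz : ∀ i e → Near (gap (src e) i) (gap (tgt e) i)
  gap-Lipschitz i (spoke a zero) with a Finₚ.≟ i
  ... | yes _ = near-sym (near-suc refl)
  ... | no  _ = near-suc (cong suc (sym (ℕₚ.+-identityʳ R)))
  gap-Lipschitz i (spoke a (suc p)) with a Finₚ.≟ i
  ... | yes _ = near-inject₁ p (R′ ∸_) (near-∸ R′ (toℕ p))
  ... | no  _ = near-inject₁ p (λ n → suc (R + n)) (near-suc (cong suc (sym (ℕₚ.+-suc R _))))
  gap-Lipschitz i (connector j a) with a Finₚ.≟ i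
  ... | yes _ = subst (λ n → Near n 0) (sym (trans (cong (R′ ∸_) (Finₚ.toℕ-fromℕ R′)) (ℕₚ.n∸n≡0 R′))) near-refl
  ... | no  _ = subst (λ n → Near n r) (sym (cong (λ n → suc (R + n)) (Finₚ.toℕ-fromℕ R′))) near-refl
  gap-Lipschitz i (step j a b zero) with a Finₚ.≟ i | b Finₚ.≟ i
  ... | yes _ | yes _ = near-refl
  ... | yes _ | no  _ = near-suc refl
  ... | no  _ | yes _ = near-sym (near-suc refl)
  ... | no  _ | no  _ = near-refl
  gap-Lipschitz i (step j a b (suc p)) with a Finₚ.≟ i | b Finₚ.≟ i
  ... | yes _ | yes _ = near-refl
  ... | yes _ | no  _ = near-inject₁ p suc (near-suc refl)
  ... | no  _ | yes _ = near-inject₁ p (ℓ ∸_) (near-∸ ℓ (toℕ p))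
  ... | no  _ | no  _ = near-refl
  gap-Lipschitz i (exit j a b) with a Finₚ.≟ i | b Finₚ.≟ i
  ... | yes _ | yes _ = near-refl
  ... | yes _ | no  _ = near-suc (cong (λ n → suc (suc n)) (Finₚ.toℕ-fromℕ _))
  ... | no  _ | yes _ = near-sym (near-suc (sym (trans (cong (ℓ ∸_) (Finₚ.toℕ-fromℕ (R′ + R′))) (ℕₚ.m+n∸n≡m 1 (R′ + R′)))))
  ... | no  _ | no  _ = near-refl

  gap-Adj : ∀ i {u v} → Adj u v → gap v i ≤ suc (gap u i)
  gap-Adj i (e , inj₁ (refl , refl)) = proj₂ (gap-Lipschitz i e)
  gap-Adj i (e , inj₂ (refl , refl)) = proj₁ (gap-Lipschitz i e)

  portGap-gap : ∀ {a i v} → Port a v → portGap a i ≤ gap v i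
  portGap-gap {a} {i} hub-port with a Finₚ.≟ i
  ... | yes _ = z≤n
  ... | no  _ = ℕₚ.≤-reflexive (sym (cong (λ n → suc (R + n)) (Finₚ.toℕ-fromℕ R′)))
  portGap-gap (layer-port j) = ℕₚ.≤-refl

  gap-port : ∀ {i v} → Port i v → gap v i ≡ 0
  gap-port {i} hub-port with i Finₚ.≟ i
  ... | yes _  = trans (cong (R′ ∸_) (Finₚ.toℕ-fromℕ R′)) (ℕₚ.n∸n≡0 R′)
  ... | no i≢i = contradiction refl i≢i
  gap-port {i} (layer-port j) with i Finₚ.≟ i
  ... | yes _  = refl
  ... | no i≢i = contradiction refl i≢i

  Internal : Edge → Set
  Internal e = piece (src e) ≡ piece (tgt e)

  crossing-ports : ∀ e → ¬ Internal e → ∃[ i ] Port i (src e) × Port i (tgt e)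
  crossing-ports (spoke i zero)          ext = contradiction refl ext
  crossing-ports (spoke i (suc p))       ext = contradiction refl ext
  crossing-ports (connector j i)         ext = i , hub-port , layer-port j
  crossing-ports (step j a b zero)       ext = contradiction refl ext
  crossing-ports (step j a b (suc p))    ext = contradiction refl ext
  crossing-ports (exit j a b)            ext = contradiction refl ext

  crossing-Adj : ∀ {u v} → Adj u v → piece u ≢ piece v → ∃[ i ] Port i u × Port i v
  crossing-Adj (e , inj₁ (refl , refl)) ext = crossing-ports e ext
  crossing-Adj (e , inj₂ (refl , refl)) ext with crossing-ports e (ext ∘ sym)
  ... | i , pu , pv = i , pv , pu

  -- The first entrance of the walk into the piece of its end is replaced by a detour inside that
  -- piece; all pieces have the same distances between ports, so nothing is lost.
  shortcut : ∀ {v x n} → Walk v x n → piece v ≢ piece x → ∀ {i b} → Port i b → piece b ≡ piece x →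
             ∃[ m ] Walk b x m × suc m ≤ n + gap v i
  shortcut nil v≁x = contradiction refl v≁x
  shortcut {v} {x} (cons {v = v′} {n = n} a w) v≁x {i} pb b∼x with piece v′ ≟ᵖ piece x
  ... | yes v′∼x with crossing-Adj a (λ v∼v′ → v≁x (trans v∼v′ v′∼x))
  ...   | i′ , pv , pv′ with port-walk pv′ pb (trans v′∼x (sym b∼x))
  -- The entering edge `a` is left out of the new walk, hence the `suc` in the bound.
  ...     | m , w′ , m≤ = m + n , reverse-walk w′ ++ʷ w , s≤s (begin
              m + n                    ≡⟨ ℕₚ.+-comm m n ⟩
              n + m                    ≤⟨ ℕₚ.+-monoʳ-≤ n (ℕₚ.≤-trans m≤ (portGap-gap pv)) ⟩
              n + gap v i              ∎)
            where open ℕₚ.≤-Reasoning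
  shortcut {v} (cons {v = v′} {n = n} a w) v≁x {i} pb b∼x | no v′≁x with shortcut w v′≁x pb b∼x
  ... | m , w′ , m<  = m , w′ , (begin
          suc m                    ≤⟨ m< ⟩
          n + gap v′ i             ≤⟨ ℕₚ.+-monoʳ-≤ n (gap-Adj i a) ⟩
          n + suc (gap v i)        ≡⟨ ℕₚ.+-suc n (gap v i) ⟩
          suc n + gap v i          ∎)
        where open ℕₚ.≤-Reasoning

  hub-connected : ∀ i p → ∃[ n ] Walk (slot i p) centre n
  hub-connected i p = _ , reverse-walk (along-hub i (suc p))

  port-connected : ∀ {i u x} → Port i u → piece u ≡ piece x → ∃[ n ] Walk u x n
  port-connected {i} {x = centre} hub-port _ = hub-connected i last
  port-connected {i} {x = slot a p} hub-port _ = _ , proj₂ (hub-connected i last) ++ʷ along-hub a (suc p)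
  port-connected {i} {x = terminal j a} (layer-port j) refl =
    _ , proj₁ (proj₂ (port-walk (layer-port j) (layer-port j) refl))
  port-connected {i} {x = inner j a b p} (layer-port j) refl =
    _ , proj₁ (proj₂ (port-walk (layer-port j) (layer-port {a} j) refl)) ++ʷ along-path j a b (suc p)

  -- The gap between `v` and the port `i` is zero, so `shortcut` turns every walk from `v` to `x`
  -- into a strictly shorter one from `u`. The double negation comes from the existence of the two
  -- distances.
  leaving-is-further : ∀ {i u v x} → Adj u v → Port i u → Port i v →
    piece u ≢ piece v → piece u ≡ piece x → ¬ ¬ MovesFurther u v x
  leaving-is-further {x = x} a pu pv u≁v u∼x ¬further with port-connected pu u∼x
  ... | n , w = ¬¬least n w λ (m , um) → ¬¬least (suc n) (cons (symm a) w) λ (m′ , vm′) →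
          ¬further (m , m′ , um , vm′ , closer um vm′)
    where
    closer : ∀ {m m′} → IsDistance _ x m → IsDistance _ x m′ → m < m′
    closer {m} {m′} (_ , least) (w′ , _) with shortcut w′ (λ v∼x → u≁v (trans u∼x (sym v∼x))) pu u∼x
    ... | c , w″ , c< = ℕₚ.≤-trans (s≤s (least c w″)) (subst (suc c ≤_)
            (trans (cong (m′ +_) (gap-port pv)) (ℕₚ.+-identityʳ m′)) c<)

  open SwapSequences _≟_ _≟ᵉ_ src tgt src≢tgt public
  open FiniteVertices (proj₂ finite-Vertex) public

-- The schedule through the hub and the target assignment

module Schedule (k′ R′ : ℕ) where

  open import Data.Nat.Base using (_≤_; _<_; _+_; _*_; _∸_; _%_; z≤n; s≤s)
  open Construction k′ R′

  -- Swapping from the outermost edge inwards rotates a path: the token at its end runs to the start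
  -- and all others advance by one.
  descending : ∀ {n} → (Fin n → Edge) → List Edge
  descending {zero}  f = []
  descending {suc n} f = f (fromℕ n) ∷ descending (f ∘ inject₁)

  length-descending : ∀ {n} (f : Fin n → Edge) → length (descending f) ≡ n
  length-descending {zero}  f = refl
  length-descending {suc n} f = cong suc (length-descending (f ∘ inject₁))

  Traces : ∀ {n} → (Fin (suc n) → Vertex) → (Fin n → Edge) → Set
  Traces x f = ∀ p → src (f p) ≡ x (inject₁ p) × tgt (f p) ≡ x (suc p)

  run-descending-off : ∀ {n} {x} (f : Fin n → Edge) → Traces x f →
    ∀ {v} → (∀ p → v ≢ x p) → run (descending f) v ≡ v
  run-descending-off {zero}  f tr off = refl
  run-descending-off {suc n} {x} f tr {v} off = trans
    (cong (run (descending (f ∘ inject₁)))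
      (transpose-other (off _ ∘ λ eq → trans eq (proj₁ (tr (fromℕ n)))) (off _ ∘ λ eq → trans eq (proj₂ (tr (fromℕ n))))))
    (run-descending-off (f ∘ inject₁) (tr ∘ inject₁) (off ∘ inject₁))

  run-descending-last : ∀ {n} {x} (f : Fin n → Edge) → Traces x f →
    run (descending f) (x (fromℕ n)) ≡ x zero
  run-descending-last {zero}  f tr = refl
  run-descending-last {suc n} {x} f tr = trans (cong (run (descending (f ∘ inject₁))) (begin
      swap (f (fromℕ n)) (x (suc (fromℕ n)))   ≡⟨ cong (swap (f (fromℕ n))) (proj₂ (tr (fromℕ n))) ⟨
      swap (f (fromℕ n)) (tgt (f (fromℕ n)))   ≡⟨ transpose-right _ _ ⟩
      src (f (fromℕ n))                        ≡⟨ proj₁ (tr (fromℕ n)) ⟩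
      x (inject₁ (fromℕ n))                    ∎))
    (run-descending-last {x = x ∘ inject₁} (f ∘ inject₁) (tr ∘ inject₁))
    where open ≡-Reasoning

  -- Swaps further out do not touch the token, the edge `f p` moves it one node outwards, and the
  -- later swaps no longer reach it.
  run-descending-shift : ∀ {n} {x} (f : Fin n → Edge) → Injective _≡_ _≡_ x → Traces x f →
    ∀ p → run (descending f) (x (inject₁ p)) ≡ x (suc p)
  run-descending-shift {suc n} {x} f inj tr p with view p
  ... | ‵fromℕ = trans (cong (run (descending (f ∘ inject₁))) (begin
          swap (f (fromℕ n)) (x (inject₁ (fromℕ n)))   ≡⟨ cong (swap (f (fromℕ n))) (proj₁ (tr (fromℕ n))) ⟨
          swap (f (fromℕ n)) (src (f (fromℕ n)))       ≡⟨ transpose-left _ _ ⟩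
          tgt (f (fromℕ n))                            ≡⟨ proj₂ (tr (fromℕ n)) ⟩
          x (suc (fromℕ n))                            ∎))
        (run-descending-off {x = x ∘ inject₁} (f ∘ inject₁) (tr ∘ inject₁)
          (λ q eq → Finₚ.fromℕ≢inject₁ (inj eq)))
        where open ≡-Reasoning
  ... | ‵inject₁ q = trans (cong (run (descending (f ∘ inject₁))) (transpose-other
          (λ eq → Finₚ.fromℕ≢inject₁ (Finₚ.inject₁-injective (sym (inj (trans eq (proj₁ (tr (fromℕ n))))))))
          (λ eq → Finₚ.fromℕ≢inject₁ (sym (inj (trans eq (proj₂ (tr (fromℕ n)))))))))
        (run-descending-shift {x = x ∘ inject₁} (f ∘ inject₁) (Finₚ.inject₁-injective ∘ inj) (tr ∘ inject₁) q)

  -- The terminal exchanged with the hub at time `m`. Layers and branches run through separate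
  -- cycles of coprime lengths, so every terminal becomes a door.
  door : ℕ → Vertex
  door m = terminal (m mod s) (m mod k)

  -- One pull brings the token on the current door to the centre; the centre and the branch move outwards.
  pull : ℕ → List Edge
  pull m = connector (m mod s) (m mod k) ∷ descending (spoke (m mod k))

  hubNode-traces : ∀ i → Traces (hubNode i) (spoke i)
  hubNode-traces i p = refl , refl

  hubNode-injective : ∀ i → Injective _≡_ _≡_ (hubNode i)
  hubNode-injective i {zero}  {zero}  refl = refl
  hubNode-injective i {suc p} {suc q} refl = refl

  pull-door : ∀ m → run (pull m) (door m) ≡ centre
  pull-door m = trans (cong (run (descending (spoke (m mod k)))) (transpose-right _ _))
    (run-descending-last {x = hubNode _} (spoke (m mod k)) (hubNode-traces (m mod k)))

  pull-centre : ∀ m → run (pull m) centre ≡ slot (m mod k) zero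
  pull-centre m = trans
    (cong (run (descending (spoke (m mod k)))) (transpose-other (λ ()) λ ()))
    (run-descending-shift (spoke (m mod k)) (hubNode-injective _) (hubNode-traces _) zero)

  pull-slot : ∀ m p → run (pull m) (slot (m mod k) (inject₁ p)) ≡ slot (m mod k) (suc p)
  pull-slot m p = trans
    (cong (run (descending (spoke (m mod k)))) (transpose-other (Finₚ.fromℕ≢inject₁ ∘ sym ∘ proj₂ ∘ slot-injective) λ ()))
    (run-descending-shift (spoke (m mod k)) (hubNode-injective _) (hubNode-traces _) (suc p))

  pull-last : ∀ m → run (pull m) (slot (m mod k) last) ≡ door m
  pull-last m = trans (cong (run (descending (spoke (m mod k)))) (transpose-left _ _))
    (run-descending-off {x = hubNode _} (spoke (m mod k)) (hubNode-traces _) λ { zero () ; (suc _) () })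

  pull-other : ∀ m {v} → v ≢ door m → v ≢ centre → (∀ p → v ≢ slot (m mod k) p) → run (pull m) v ≡ v
  pull-other m ≢door ≢centre ≢slot = trans
    (cong (run (descending (spoke (m mod k)))) (transpose-other (≢slot last) ≢door))
    (run-descending-off {x = hubNode _} (spoke (m mod k)) (hubNode-traces _) λ { zero → ≢centre ; (suc p) → ≢slot p })

  pulls : ℕ → ℕ → List Edge
  pulls m zero    = []
  pulls m (suc n) = pull m ++ pulls (suc m) n

  length-pulls : ∀ m n → length (pulls m n) ≡ n * suc R
  length-pulls m zero    = refl
  length-pulls m (suc n) = trans (Listₚ.length-++ (pull m))
    (cong₂ _+_ (cong suc (length-descending (spoke (m mod k)))) (length-pulls (suc m) n))

  run-pulls-suc : ∀ m n v → run (pulls m (suc n)) v ≡ run (pulls (suc m) n) (run (pull m) v)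
  run-pulls-suc m n = run-++ (pull m) (pulls (suc m) n)

  run-pulls-+ : ∀ m n o v → run (pulls m (n + o)) v ≡ run (pulls (m + n) o) (run (pulls m n) v)
  run-pulls-+ m zero    o v = cong (λ m → run (pulls m o) v) (sym (ℕₚ.+-identityʳ m))
  run-pulls-+ m (suc n) o v = begin
    run (pulls m (suc n + o)) v                                    ≡⟨ run-pulls-suc m (n + o) v ⟩
    run (pulls (suc m) (n + o)) (run (pull m) v)                   ≡⟨ run-pulls-+ (suc m) n o _ ⟩
    run (pulls (suc m + n) o) (run (pulls (suc m) n) (run (pull m) v))
      ≡⟨ cong₂ (λ a b → run (pulls a o) b) (ℕₚ.+-suc m n) (run-pulls-suc m n v) ⟨
    run (pulls (m + suc n) o) (run (pulls m (suc n)) v)            ∎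
    where open ≡-Reasoning

  run-pulls-fixed : ∀ m n v → (∀ c → c < n → run (pull (m + c)) v ≡ v) → run (pulls m n) v ≡ v
  run-pulls-fixed m zero    v fix = refl
  run-pulls-fixed m (suc n) v fix = begin
    run (pulls m (suc n)) v                ≡⟨ run-pulls-suc m n v ⟩
    run (pulls (suc m) n) (run (pull m) v) ≡⟨ cong (run (pulls (suc m) n)) (trans (cong (λ a → run (pull a) v) (sym (ℕₚ.+-identityʳ m))) (fix 0 (s≤s z≤n))) ⟩
    run (pulls (suc m) n) v                ≡⟨ run-pulls-fixed (suc m) n v (λ c c<n → trans (cong (λ a → run (pull a) v) (sym (ℕₚ.+-suc m c))) (fix (suc c) (s≤s c<n))) ⟩
    v                                      ∎
    where open ≡-Reasoning

  -- s ≡ 1 (mod k), so the doors run through all terminals with period k * s.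
  door-period : ∀ m c → door (m + c) ≡ door m → 0 < c → k * s ≤ c
  door-period m c eq 0<c with terminal-injective eq
  ... | eqˢ , eqᵏ with mod-≡⇒∣ m c s eqˢ
  ...   | divides zero    refl = contradiction 0<c λ ()
  ...   | divides (suc x) refl = ℕₚ.*-monoˡ-≤ s (∣⇒≤ (∣m+n∣m⇒∣n {m = k * (suc x * R)}
            (subst (k ∣_) (expand (suc x) k R) (mod-≡⇒∣ m _ k eqᵏ)) (m∣m*n (suc x * R))))
    where expand : ∀ x k R → x * suc (k * R) ≡ k * (x * R) + x
          expand = ℕ-Solver.solve-∀

  pull-door-other : ∀ m m′ → door m′ ≢ door m → run (pull m) (door m′) ≡ door m′
  pull-door-other m m′ ≢door = pull-other m ≢door (λ ()) (λ _ ())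

  -- The doors at times below `k * s` are pairwise distinct, so the earlier pulls happen elsewhere.
  wait-before : ∀ μ → μ < k * s → run (pulls 0 μ) (door μ) ≡ door μ
  wait-before μ μ<ks = run-pulls-fixed 0 μ (door μ) λ c c<μ → pull-door-other c μ λ eq →
    ℕₚ.<⇒≱ (ℕₚ.≤-<-trans (ℕₚ.m∸n≤m μ c) μ<ks)
      (door-period c (μ ∸ c) (trans (cong door (ℕₚ.m+[n∸m]≡n (ℕₚ.<⇒≤ c<μ))) eq) (ℕₚ.m<n⇒0<n∸m c<μ))

  wait-after : ∀ μ n → n < k * s → run (pulls (suc μ) n) (door μ) ≡ door μ
  wait-after μ n n<ks = run-pulls-fixed (suc μ) n (door μ) λ c c<n → pull-door-other (suc μ + c) μ λ eq →
    ℕₚ.<⇒≱ (ℕₚ.≤-<-trans c<n n<ks)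
      (door-period μ (suc c) (trans (cong door (ℕₚ.+-suc μ c)) (sym eq)) (s≤s z≤n))

  -- The `k - 1` pulls between two pulls of one branch all use other branches.
  idle : ∀ m p → run (pulls (suc m) k′) (slot (m mod k) p) ≡ slot (m mod k) p
  idle m p = run-pulls-fixed (suc m) k′ _ λ c c<k′ → pull-other (suc m + c) (λ ()) (λ ()) λ q eq →
    ℕₚ.<⇒≱ (s≤s c<k′)
      (∣⇒≤ (mod-≡⇒∣ m (suc c) k (trans (cong (_mod k) (ℕₚ.+-suc m c)) (sym (proj₁ (slot-injective eq))))))

  run-block : ∀ m p → run (pulls (suc m) k) (slot (m mod k) p) ≡ run (pull (m + k)) (slot ((m + k) mod k) p)
  run-block m p = begin
    run (pulls (suc m) k) (slot (m mod k) p)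
      ≡⟨ cong (λ n → run (pulls (suc m) n) (slot (m mod k) p)) (ℕₚ.+-comm 1 k′) ⟩
    run (pulls (suc m) (k′ + 1)) (slot (m mod k) p)
      ≡⟨ run-pulls-+ (suc m) k′ 1 _ ⟩
    run (pulls (suc m + k′) 1) (run (pulls (suc m) k′) (slot (m mod k) p))
      ≡⟨ cong₂ (λ n v → run (pulls n 1) v) (sym (ℕₚ.+-suc m k′)) (idle m p) ⟩
    run (pulls (m + k) 1) (slot (m mod k) p)
      ≡⟨ run-pulls-suc (m + k) 0 _ ⟩
    run (pull (m + k)) (slot (m mod k) p)
      ≡⟨ cong (λ i → run (pull (m + k)) (slot i p)) (mod-cong m (m + k) k (sym (trans (cong (λ c → (m + c) % k) (sym (ℕₚ.*-identityˡ k))) ([m+kn]%n≡m%n m 1 k)))) ⟩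
    run (pull (m + k)) (slot ((m + k) mod k) p)
      ∎
    where open ≡-Reasoning

  -- Each round of `k` pulls contains one pull of the given branch and advances the token by one
  -- slot.
  run-blocks : ∀ n p q m → toℕ q ≡ toℕ p + n →
    run (pulls (suc m) (n * k)) (slot (m mod k) p) ≡ slot ((m + n * k) mod k) q
  run-blocks zero p q m eq = cong₂ (λ i → slot (i mod k)) (sym (ℕₚ.+-identityʳ m))
    (Finₚ.toℕ-injective (sym (trans eq (ℕₚ.+-identityʳ (toℕ p)))))
  run-blocks (suc n) p q m eq with view p
  -- From the last slot no further slot `q` could be reached.
  ... | ‵fromℕ = contradiction (subst (_< R) eq (Finₚ.toℕ<n q))
          (ℕₚ.≤⇒≯ (subst (λ a → R ≤ a + suc n) (sym (Finₚ.toℕ-fromℕ R′))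
            (ℕₚ.≤-trans (s≤s (ℕₚ.m≤m+n R′ n)) (ℕₚ.≤-reflexive (sym (ℕₚ.+-suc R′ n))))))
  ... | ‵inject₁ p = begin
    run (pulls (suc m) (k + n * k)) (slot (m mod k) (inject₁ p))
      ≡⟨ run-pulls-+ (suc m) k (n * k) _ ⟩
    run (pulls (suc (m + k)) (n * k)) (run (pulls (suc m) k) (slot (m mod k) (inject₁ p)))
      ≡⟨ cong (run (pulls (suc (m + k)) (n * k))) (trans (run-block m (inject₁ p)) (pull-slot (m + k) p)) ⟩
    run (pulls (suc (m + k)) (n * k)) (slot ((m + k) mod k) (suc p))
      ≡⟨ run-blocks n (suc p) q (m + k) (trans eq (trans (cong (_+ suc n) (Finₚ.toℕ-inject₁ p)) (ℕₚ.+-suc (toℕ p) n))) ⟩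
    slot ((m + k + n * k) mod k) q
      ≡⟨ cong (λ a → slot (a mod k) q) (ℕₚ.+-assoc m k (n * k)) ⟩
    slot ((m + (k + n * k)) mod k) q
      ∎
    where open ≡-Reasoning

  -- A token pulled at time μ enters the next branch, which is pulled R more times before it leaves.
  transit : ∀ μ → run (pulls μ (suc s)) (door μ) ≡ door (μ + s)
  transit μ = begin
    run (pulls μ (suc s)) (door μ)
      ≡⟨ run-pulls-suc μ s _ ⟩
    run (pulls (suc μ) s) (run (pull μ) (door μ))
      ≡⟨ cong (run (pulls (suc μ) s)) (pull-door μ) ⟩
    run (pulls (suc μ) s) centre
      ≡⟨ run-pulls-suc (suc μ) (k * R) _ ⟩
    run (pulls (suc (suc μ)) (k * R)) (run (pull (suc μ)) centre)
      ≡⟨ cong₂ (λ n → run (pulls (suc (suc μ)) n)) (split k′ R′) (pull-centre (suc μ)) ⟩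
    run (pulls (suc (suc μ)) (R′ * k + k)) (slot (suc μ mod k) zero)
      ≡⟨ run-pulls-+ (suc (suc μ)) (R′ * k) k _ ⟩
    run (pulls (suc (suc μ + R′ * k)) k) (run (pulls (suc (suc μ)) (R′ * k)) (slot (suc μ mod k) zero))
      ≡⟨ cong (run (pulls (suc (suc μ + R′ * k)) k)) (run-blocks R′ zero last (suc μ) (Finₚ.toℕ-fromℕ R′)) ⟩
    run (pulls (suc (suc μ + R′ * k)) k) (slot ((suc μ + R′ * k) mod k) last)
      ≡⟨ run-block (suc μ + R′ * k) last ⟩
    run (pull (suc μ + R′ * k + k)) (slot ((suc μ + R′ * k + k) mod k) last)
      ≡⟨ pull-last (suc μ + R′ * k + k) ⟩
    door (suc μ + R′ * k + k)
      ≡⟨ cong door (collect μ k′ R′) ⟩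
    door (μ + s)
      ∎
    where
    open ≡-Reasoning
    split : ∀ k′ R′ → suc k′ * suc R′ ≡ R′ * suc k′ + suc k′
    split = ℕ-Solver.solve-∀
    collect : ∀ μ k′ R′ → suc μ + R′ * suc k′ + suc k′ ≡ μ + suc (suc k′ * suc R′)
    collect = ℕ-Solver.solve-∀

  -- The last terminal is first a door at time `k * s - 1`, and a transit takes `s + 1` pulls, so
  -- every terminal token has arrived after `(k + 1) * s` pulls.
  horizon : ℕ
  horizon = suc k * s

  schedule : List Edge
  schedule = pulls 0 horizon

  -- The target assignment is by definition the outcome of the schedule; the destination of a hub
  -- token is wherever the schedule leaves it.
  F : Vertex → Vertex
  F = run schedule

  -- The token waits until time `μ`, passes through the hub, and then rests: its new door does not
  -- recur before the end.
  F-door : ∀ μ → μ < k * s → F (door μ) ≡ door (μ + s)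
  F-door μ μ<ks with ℕₚ.m≤n⇒∃[o]m+o≡n μ<ks
  ... | o , split = begin
    run (pulls 0 horizon) (door μ)
      ≡⟨ cong (λ n → run (pulls 0 n) (door μ)) (trans (cong (s +_) (sym split)) (regroup s μ o)) ⟩
    run (pulls 0 (μ + (suc s + o))) (door μ)
      ≡⟨ run-pulls-+ 0 μ (suc s + o) _ ⟩
    run (pulls μ (suc s + o)) (run (pulls 0 μ) (door μ))
      ≡⟨ cong (run (pulls μ (suc s + o))) (wait-before μ μ<ks) ⟩
    run (pulls μ (suc s + o)) (door μ)
      ≡⟨ run-pulls-+ μ (suc s) o _ ⟩
    run (pulls (μ + suc s) o) (run (pulls μ (suc s)) (door μ))
      ≡⟨ cong₂ (λ m → run (pulls m o)) (ℕₚ.+-suc μ s) (transit μ) ⟩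
    run (pulls (suc (μ + s)) o) (door (μ + s))
      ≡⟨ wait-after (μ + s) o (subst (o <_) split (s≤s (ℕₚ.m≤n+m o μ))) ⟩
    door (μ + s)
      ∎
    where
    open ≡-Reasoning
    regroup : ∀ s μ o → s + (suc μ + o) ≡ μ + (suc s + o)
    regroup = ℕ-Solver.solve-∀

  door-surjective : ∀ j i → ∃[ μ ] μ < k * s × door μ ≡ terminal j i
  door-surjective j i = μ , bound , cong₂ terminal layer-eq branch-eq
    where
    q μ : ℕ
    -- `k′` is -1 modulo `k`, so `q` represents `i - j`; as `s` is 1 modulo `k`, `μ = j + q * s` has
    -- residues `j` modulo `s` and `i` modulo `k`.
    q = (toℕ i + k′ * toℕ j) % k
    μ = toℕ j + q * s
    bound : μ < k * s
    bound = ℕₚ.<-≤-trans (ℕₚ.+-monoˡ-< (q * s) (Finₚ.toℕ<n j)) (ℕₚ.*-monoˡ-≤ s (m%n<n (toℕ i + k′ * toℕ j) k))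
    layer-eq : μ mod s ≡ j
    layer-eq = Finₚ.toℕ-injective (trans (toℕ-mod μ s)
      (trans ([m+kn]%n≡m%n (toℕ j) q s) (m<n⇒m%n≡m (Finₚ.toℕ<n j))))
    open ≡-Reasoning
    branch-eq : μ mod k ≡ i
    branch-eq = Finₚ.toℕ-injective (begin
      toℕ (μ mod k)                                  ≡⟨ toℕ-mod μ k ⟩
      (toℕ j + q * s) % k                            ≡⟨ cong (_% k) (expand (toℕ j) q k R) ⟩
      (toℕ j + q + q * R * k) % k                    ≡⟨ [m+kn]%n≡m%n (toℕ j + q) (q * R) k ⟩
      (toℕ j + q) % k                                ≡⟨ %-distribˡ-+ (toℕ j) q k ⟩
      (toℕ j % k + q % k) % k                        ≡⟨ cong (λ a → (toℕ j % k + a) % k) (m%n%n≡m%n (toℕ i + k′ * toℕ j) k) ⟩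
      (toℕ j % k + (toℕ i + k′ * toℕ j) % k) % k     ≡⟨ %-distribˡ-+ (toℕ j) (toℕ i + k′ * toℕ j) k ⟨
      (toℕ j + (toℕ i + k′ * toℕ j)) % k             ≡⟨ cong (_% k) (gather (toℕ i) (toℕ j) k′) ⟩
      (toℕ i + toℕ j * k) % k                        ≡⟨ [m+kn]%n≡m%n (toℕ i) (toℕ j) k ⟩
      toℕ i % k                                      ≡⟨ m<n⇒m%n≡m (Finₚ.toℕ<n i) ⟩
      toℕ i                                          ∎)
      where
      expand : ∀ j q k R → j + q * suc (k * R) ≡ j + q + q * R * k
      expand = ℕ-Solver.solve-∀
      gather : ∀ i j k′ → j + (i + k′ * j) ≡ i + j * suc k′
      gather = ℕ-Solver.solve-∀

  -- `s` is 0 modulo `s` and 1 modulo `k`: the layer is kept and the terminal advances by one.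
  door-+s : ∀ μ → door (μ + s) ≡ terminal (μ mod s) (next (μ mod k))
  door-+s μ = cong₂ terminal
    (mod-cong (μ + s) μ s (trans (cong (λ a → (μ + a) % s) (sym (ℕₚ.*-identityˡ s))) ([m+kn]%n≡m%n μ 1 s)))
    (mod-cong (μ + s) (suc (toℕ (μ mod k))) k (begin
      (μ + s) % k                        ≡⟨ cong (_% k) (regroup μ k R) ⟩
      (suc μ + R * k) % k                ≡⟨ [m+kn]%n≡m%n (suc μ) R k ⟩
      (1 + μ) % k                        ≡⟨ %-distribˡ-+ 1 μ k ⟩
      (1 % k + μ % k) % k                ≡⟨ cong (λ a → (1 % k + a) % k) (m%n%n≡m%n μ k) ⟨
      (1 % k + μ % k % k) % k            ≡⟨ %-distribˡ-+ 1 (μ % k) k ⟨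
      suc (μ % k) % k                    ≡⟨ cong (λ a → suc a % k) (toℕ-mod μ k) ⟨
      suc (toℕ (μ mod k)) % k            ∎))
    where
    open ≡-Reasoning
    regroup : ∀ μ k R → μ + suc (k * R) ≡ suc μ + R * k
    regroup = ℕ-Solver.solve-∀

  F-terminal : ∀ j i → F (terminal j i) ≡ terminal j (next i)
  F-terminal j i with door-surjective j i
  ... | μ , μ<ks , eq with terminal-injective eq
  ... | refl , refl = trans (F-door μ μ<ks) (door-+s μ)

  F-inner : ∀ j a b p → F (inner j a b p) ≡ inner j a b p
  F-inner j a b p = run-pulls-fixed 0 horizon _ λ c _ → pull-other c (λ ()) (λ ()) (λ _ ())

  F-injective : Injective _≡_ _≡_ F
  F-injective = run-injective schedule

  next-surjective : ∀ i → ∃[ i′ ] next {k′} i′ ≡ i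
  next-surjective zero    = fromℕ k′ , Finₚ.toℕ-injective (trans (toℕ-mod (suc (toℕ (fromℕ k′))) k)
    (trans (cong (λ a → suc a % k) (Finₚ.toℕ-fromℕ k′)) (n%n≡0 k)))
  next-surjective (suc i) = inject₁ i , next-inject₁ i

  -- `F` is injective and already maps the layer vertices onto themselves, so no hub vertex can land
  -- in a layer.
  hub-closed : ∀ v → piece v ≡ nothing → piece (F v) ≡ nothing
  hub-closed v in-hub with F v in eq
  ... | centre   = refl
  ... | slot _ _ = refl
  ... | inner j a b p with F-injective (trans eq (sym (F-inner j a b p)))
  ...   | refl = in-hub
  hub-closed v in-hub | terminal j i with next-surjective i
  ... | i′ , refl with F-injective (trans eq (sym (F-terminal j i′)))
  ...   | refl = in-hub

  piece-F : ∀ v → piece (F v) ≡ piece v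
  piece-F (terminal j i)  = cong piece (F-terminal j i)
  piece-F (inner j a b p) = cong piece (F-inner j a b p)
  piece-F centre          = hub-closed centre refl
  piece-F (slot i p)      = hub-closed (slot i p) refl

-- The lower bound for sequences inside the pieces

module LowerBound (k′ R′ : ℕ) where

  open import Data.Nat.Base using (_≤_; _<_; _+_; _*_; z≤n; s≤s)
  open import Data.Integer.Base using (+_; 0ℤ; 1ℤ; -1ℤ)
  open Construction k′ R′
  open Schedule k′ R′

  connector-external : ∀ j i → ¬ Internal (connector j i)
  connector-external _ _ ()

  -- Inner vertices take the colour of the start of their path, so the coboundary can be nonzero
  -- only on connectors and exits of layer `j`.
  layerPotential : ∀ {c} → Fin s → (Fin k → Fin c) → Vertex → ℤ
  layerPotential j χ centre     = 0ℤ
  layerPotential j χ (slot _ _) = 0ℤ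
  layerPotential j χ (terminal j′ i) with j Finₚ.≟ j′
  ... | yes _ = + toℕ (χ i)
  ... | no  _ = 0ℤ
  layerPotential j χ (inner j′ a b p) with j Finₚ.≟ j′
  ... | yes _ = + toℕ (χ a)
  ... | no  _ = 0ℤ

  layerPotential-terminal : ∀ {c} j (χ : Fin k → Fin c) i → layerPotential j χ (terminal j i) ≡ + toℕ (χ i)
  layerPotential-terminal j χ i with j Finₚ.≟ j
  ... | yes _  = refl
  ... | no j≢j = contradiction refl j≢j

  at : Vertex → Vertex → ℤ
  at v x with x ≟ v
  ... | yes _ = 1ℤ
  ... | no  _ = 0ℤ

  at-cong : ∀ v {x y} → (x ≡ v → y ≡ v) → (y ≡ v → x ≡ v) → at v x ≡ at v y
  at-cong v {x} {y} to from with x ≟ v | y ≟ v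
  ... | yes _  | yes _  = refl
  ... | no _   | no _   = refl
  ... | yes x≡ | no y≢  = contradiction (to x≡) y≢
  ... | no x≢  | yes y≡ = contradiction (from y≡) x≢

  at-δ : ∀ {v x e e′} → (x ≡ v → e ≡ e′) → (e ≡ e′ → x ≡ v) → at v x ≡ δ e e′
  at-δ {v} {x} {e} {e′} to from with x ≟ v | e ≟ᵉ e′
  ... | yes _  | yes _ = refl
  ... | no _   | no _  = refl
  ... | yes x≡ | no e≢ = contradiction (to x≡) e≢
  ... | no x≢  | yes e≡ = contradiction (from e≡) x≢

  tgt-inner : ∀ {j a b p} e → tgt e ≡ inner j a b p → step j a b p ≡ e
  tgt-inner (step _ _ _ _) refl = refl

  Path : Set
  Path = Fin s × Fin k × Fin k

  path : Edge → Maybe Path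
  path (spoke _ _)     = nothing
  path (connector _ _) = nothing
  path (step j a b _)  = just (j , a , b)
  path (exit j a b)    = just (j , a , b)

  _≟ᵖᵃᵗʰ_ : DecidableEquality Path
  _≟ᵖᵃᵗʰ_ = Productₚ.≡-dec Finₚ._≟_ (Productₚ.≡-dec Finₚ._≟_ Finₚ._≟_)

  pathEdges : Path → List Edge
  pathEdges (j , a , b) = exit j a b ∷ map (step j a b) (allFin ℓ)

  length-pathEdges : ∀ π → length (pathEdges π) ≡ r
  length-pathEdges (j , a , b) = cong suc (trans (Listₚ.length-map (step j a b) (allFin ℓ)) (Listₚ.length-tabulate id))

  unique-pathEdges : ∀ π → Unique (pathEdges π)
  unique-pathEdges (j , a , b) =
    All.tabulate (λ e∈ eq → exit∉ (∈-map⁻ (step j a b) e∈) eq) ∷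
    Uniqueₚ.map⁺ (λ { refl → refl }) (Uniqueₚ.allFin⁺ ℓ)
    where
    exit∉ : ∀ {e} → ∃[ p ] p ∈ allFin ℓ × e ≡ step j a b p → exit j a b ≢ e
    exit∉ (p , _ , refl) ()

  module _ (es : List Edge) (internal : All Internal es) (solves : ∀ x → run es x ≡ F x)
           (once : ∀ x y → meetings x y es ≤ 1) where

    ∫-d : ∀ φ x → φ (F x) ≡ φ x → ∫ (d φ) es x ≡ 0ℤ
    ∫-d φ x eq = identityʳ-unique (φ x) _ (begin
      φ x ℤ.+ ∫ (d φ) es x   ≡⟨ stokes φ es x ⟨
      φ (run es x)           ≡⟨ cong φ (solves x) ⟩
      φ (F x)                ≡⟨ eq ⟩
      φ x                    ∎)
      where open ≡-Reasoning

    -- Inner vertices are fixed by F, so the flow of every token is conserved there.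
    flow-conserved : ∀ {j a b p} out → src out ≡ inner j a b p →
      (∀ e → src e ≡ inner j a b p → out ≡ e) → ∀ x → flow (step j a b p) es x ≡ flow out es x
    flow-conserved {j} {a} {b} {p} out src-out only x = ℤₚ.i-j≡0⇒i≡j _ _ (begin
      flow (step j a b p) es x ℤ.- flow out es x
        ≡⟨ cong (ℤ._+_ (flow (step j a b p) es x)) (ℤₚ.-1*i≡-i _) ⟨
      flow (step j a b p) es x ℤ.+ -1ℤ ℤ.* flow out es x
        ≡⟨ ∫-linear (δ (step j a b p)) -1ℤ (δ out) es x ⟨
      ∫ (λ e → δ (step j a b p) e ℤ.+ -1ℤ ℤ.* δ out e) es x
        ≡⟨ ∫-cong boundary es x ⟨
      ∫ (d (at v)) es x
        ≡⟨ ∫-d (at v) x (at-cong v (λ eq → F-injective (trans eq (sym (F-inner j a b p))))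
                                    (λ { refl → F-inner j a b p })) ⟩
      0ℤ ∎)
      where
      open ≡-Reasoning
      v = inner j a b p
      boundary : ∀ e → d (at v) e ≡ δ (step j a b p) e ℤ.+ -1ℤ ℤ.* δ out e
      boundary e = cong₂ ℤ._+_
        (at-δ (tgt-inner e) (λ { refl → refl }))
        (trans (cong ℤ.-_ (at-δ (only e) (λ { refl → src-out }))) (sym (ℤₚ.-1*i≡-i _)))

    -- Conservation is applied at one inner vertex after another, from the exit back to the start of
    -- the path.
    flow-constant : ∀ j a b x p → flow (step j a b p) es x ≡ flow (exit j a b) es x
    flow-constant j a b x = >-weakInduction _
      (flow-conserved (exit j a b) refl only-exit x)
      (λ p eq → trans (flow-conserved (step j a b (suc p)) refl (only-step p) x) eq)
      where
      only-exit : ∀ e → src e ≡ inner j a b (fromℕ _) → exit j a b ≡ e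
      only-exit (spoke _ zero)       ()
      only-exit (spoke _ (suc _))    ()
      only-exit (exit _ _ _)         refl = refl
      only-exit (step _ _ _ (suc q)) eq with inner-injective eq
      ... | _ , _ , _ , p≡ = contradiction (sym p≡) Finₚ.fromℕ≢inject₁
      only-step : ∀ p e → src e ≡ inner j a b (inject₁ p) → step j a b (suc p) ≡ e
      only-step p (spoke _ zero)         ()
      only-step p (spoke _ (suc _))      ()
      only-step p (exit _ _ _)           eq with inner-injective eq
      ... | _ , _ , _ , p≡ = contradiction p≡ Finₚ.fromℕ≢inject₁
      only-step p (step _ _ _ (suc q))   eq with inner-injective eq
      ... | refl , refl , refl , p≡ = cong (step j a b ∘ suc) (Finₚ.inject₁-injective (sym p≡))

    on? : ∀ π e → Dec (path e ≡ just π)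
    on? π e = Maybeₚ.≡-dec _≟ᵖᵃᵗʰ_ (path e) (just π)

    -- The flow is nonzero on all `r` edges of the path, and each of them requires a move of its
    -- own.
    crossing-moves : ∀ j a b x → flow (exit j a b) es x ≢ 0ℤ → r ≤ count (on? (j , a , b)) (moves es x)
    crossing-moves j a b x nz = subst (_≤ count (on? (j , a , b)) (moves es x)) (length-pathEdges (j , a , b))
      (unique-⊆-length _≟ᵉ_ (unique-pathEdges (j , a , b)) _ crossed)
      where
      crossed : ∀ {e} → e ∈ pathEdges (j , a , b) → e ∈ filter (on? (j , a , b)) (moves es x)
      crossed (here refl) = ∈-filter⁺ (on? (j , a , b)) (flow≢0⇒∈moves es x nz) refl
      crossed (there e∈) with ∈-map⁻ (step j a b) e∈
      ... | p , _ , refl = ∈-filter⁺ (on? (j , a , b))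
              (flow≢0⇒∈moves es x (nz ∘ trans (sym (flow-constant j a b x p)))) refl

    -- The tokens tested are those starting on terminals of the layer; along their trajectories the
    -- colour potential is integrated below.
    Used : Path → Set
    Used (j , a , b) = ∃[ i ] flow (exit j a b) es (terminal j i) ≢ 0ℤ

    used? : Decidable Used
    used? (j , a , b) = Finₚ.any? λ i → ¬? (flow (exit j a b) es (terminal j i) ℤₚ.≟ 0ℤ)

    -- The total flow through a path vanishes, so a second token traverses a used path as well.
    used-path-bound : ∀ π → Used π → r + ℓ ≤ count (on? π) es
    used-path-bound π@(j , a , b) (i , nz) with another-flow (exit j a b) es (terminal j i) nz
    ... | y , y≢x , nz′ = ℕₚ.≤-pred (begin
      suc (r + ℓ)                                                  ≡⟨ ℕₚ.+-suc r ℓ ⟨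
      r + r                                                        ≤⟨ ℕₚ.+-mono-≤ (crossing-moves j a b y nz′) (crossing-moves j a b _ nz) ⟩
      count (on? π) (moves es y) + count (on? π) (moves es (terminal j i))
                                                                   ≤⟨ count-moves (on? π) y≢x es ⟩
      count (on? π) es + meetings y (terminal j i) es              ≤⟨ ℕₚ.+-monoʳ-≤ _ (once y (terminal j i)) ⟩
      count (on? π) es + 1                                         ≡⟨ ℕₚ.+-comm _ 1 ⟩
      suc (count (on? π) es)                                       ∎)
      where open ℕₚ.≤-Reasoning

    paths usedPaths : List Path
    paths     = cartesianProduct (allFin s) (cartesianProduct (allFin k) (allFin k))
    usedPaths = filter used? paths

    unique-usedPaths : Unique usedPaths
    unique-usedPaths = Uniqueₚ.filter⁺ used? (Uniqueₚ.cartesianProduct⁺ (Uniqueₚ.allFin⁺ s)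
      (Uniqueₚ.cartesianProduct⁺ (Uniqueₚ.allFin⁺ k) (Uniqueₚ.allFin⁺ k)))

    used∈ : ∀ {π} → Used π → π ∈ usedPaths
    used∈ {j , a , b} used = ∈-filter⁺ used?
      (∈-cartesianProduct⁺ (∈-allFin j) (∈-cartesianProduct⁺ (∈-allFin a) (∈-allFin b))) used

    module _ {c} (j : Fin s) (χ : Fin k → Fin c) (respects : ∀ a b → Used (j , a , b) → χ a ≡ χ b) where

      private
        φ = layerPotential j χ

      -- One factor is always zero: connectors do not occur in `es`, an exit of layer `j` with flow
      -- has ends of equal colour, and `d φ` vanishes on all other edges.
      colour-flow : ∀ i e → d φ e ℤ.* flow e es (terminal j i) ≡ 0ℤ
      colour-flow i e with flow e es (terminal j i) ℤₚ.≟ 0ℤ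
      ... | yes z = trans (cong (ℤ._*_ (d φ e)) z) (ℤₚ.*-zeroʳ (d φ e))
      ... | no nz = cong (λ n → n ℤ.* flow e es (terminal j i)) (dφ≡0 e nz)
        where
        dφ≡0 : ∀ e → flow e es (terminal j i) ≢ 0ℤ → d φ e ≡ 0ℤ
        dφ≡0 (spoke _ zero)       _ = refl
        dφ≡0 (spoke _ (suc p))    _ = refl
        dφ≡0 (connector j′ i′)    nz = contradiction
          (All.lookup internal (moves⊆ es (terminal j i) (flow≢0⇒∈moves es (terminal j i) nz)))
          (connector-external j′ i′)
        dφ≡0 (step j′ a b zero)    _ with j Finₚ.≟ j′
        ... | yes _ = ℤₚ.+-inverseʳ (+ toℕ (χ a))
        ... | no  _ = refl
        dφ≡0 (step j′ a b (suc p)) _ with j Finₚ.≟ j′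
        ... | yes _ = ℤₚ.+-inverseʳ (+ toℕ (χ a))
        ... | no  _ = refl
        dφ≡0 (exit j′ a b) nz with j Finₚ.≟ j′
        ... | no  _    = refl
        ... | yes refl = trans (cong (λ y → + toℕ y ℤ.- + toℕ (χ a)) (sym (respects a b (i , nz))))
                               (ℤₚ.+-inverseʳ (+ toℕ (χ a)))

      -- The token from terminal `i` ends on terminal `next i`, and the integral measuring its
      -- change of colour is zero.
      colour-next : ∀ i → χ (next i) ≡ χ i
      colour-next i = Finₚ.toℕ-injective (ℤₚ.+-injective (begin
        + toℕ (χ (next i))                            ≡⟨ layerPotential-terminal j χ (next i) ⟨
        φ (terminal j (next i))                       ≡⟨ cong φ (trans (solves _) (F-terminal j i)) ⟨
        φ (run es (terminal j i))                     ≡⟨ stokes φ es (terminal j i) ⟩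
        φ (terminal j i) ℤ.+ ∫ (d φ) es (terminal j i)
          ≡⟨ cong₂ ℤ._+_ (layerPotential-terminal j χ i) (∫-zero-flow es (terminal j i) (colour-flow i)) ⟩
        + toℕ (χ i) ℤ.+ 0ℤ                            ≡⟨ ℤₚ.+-identityʳ _ ⟩
        + toℕ (χ i)                                   ∎))
        where open ≡-Reasoning

      colour-constant : ∀ i → χ i ≡ χ zero
      colour-constant = <-weakInduction _ refl λ i eq →
        trans (cong χ (sym (next-inject₁ i))) (trans (colour-next (inject₁ i)) eq)

    -- Colourings that respect the used paths are constant, so these paths connect the `k` terminals
    -- of the layer.
    layer-used : ∀ j → k′ ≤ length (fibre Finₚ._≟_ proj₁ j usedPaths)
    layer-used j = subst (k′ ≤_) (Listₚ.length-map proj₂ (fibre Finₚ._≟_ proj₁ j usedPaths))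
      (connected-length (map proj₂ (fibre Finₚ._≟_ proj₁ j usedPaths)) λ χ respects →
        colour-constant j χ λ a b used →
          respects (∈-map⁺ proj₂ (∈-filter⁺ (λ π → proj₁ π Finₚ.≟ j) (used∈ used) refl)))

    -- Swaps are grouped by path and used paths by layer: `s` layers, at least `k - 1` used paths in
    -- each, and `2r - 1` swaps on each path.
    once-bound : s * k′ * (r + ℓ) ≤ length es
    once-bound = begin
      s * k′ * (r + ℓ)
        ≡⟨ cong (λ n → n * k′ * (r + ℓ)) (Listₚ.length-tabulate {n = s} id) ⟨
      length (allFin s) * k′ * (r + ℓ)
        ≤⟨ ℕₚ.*-monoˡ-≤ (r + ℓ) (fibres-bound Finₚ._≟_ proj₁ (Uniqueₚ.allFin⁺ s) usedPaths λ {j} _ → layer-used j) ⟩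
      length usedPaths * (r + ℓ)
        ≡⟨ cong (_* (r + ℓ)) (Listₚ.length-map just usedPaths) ⟨
      length (map just usedPaths) * (r + ℓ)
        ≤⟨ fibres-bound (Maybeₚ.≡-dec _≟ᵖᵃᵗʰ_) path (Uniqueₚ.map⁺ Maybeₚ.just-injective unique-usedPaths) es large ⟩
      length es ∎
      where
      open ℕₚ.≤-Reasoning
      large : ∀ {κ} → κ ∈ map just usedPaths → r + ℓ ≤ length (fibre (Maybeₚ.≡-dec _≟ᵖᵃᵗʰ_) path κ es)
      large κ∈ with ∈-map⁻ just κ∈
      ... | π , π∈ , refl = used-path-bound π (proj₂ (∈-filter⁻ used? {xs = paths} π∈))

  -- Deleting double meetings keeps the swaps internal and never lengthens the sequence, so the
  -- previous bound carries over.
  lower-bound : ∀ es → All Internal es → (∀ x → run es x ≡ F x) → s * k′ * (r + ℓ) ≤ length es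
  lower-bound es internal solves with meet-at-most-once es internal
  ... | es′ , shorter , internal′ , same , once = ℕₚ.≤-trans
    (once-bound es′ internal′ (λ x → trans (same x) (solves x)) once) shorter

  -- The instance, its locally optimal sequences and its optimum

  K : Instance
  K = record
    { graph  = graph
    ; Token  = Vertex
    ; tokens = proj₂ finite-Vertex
    ; start  = ↣-id Vertex
    ; target = mk↣ F-injective
    }

  open Instance K
    using (Adj; Swap; applySwap; applySwaps; Solves; LocallyOptimalFrom; LocallyOptimal; IsOPT)

  applySwap-transpose : ∀ {u v} (a : Adj u v) f t → applySwap (u , v , a) f t ≡ transpose u v (f t)
  applySwap-transpose {u} {v} a f t with f t ≟ u
  ... | yes _ = refl
  ... | no  _ with f t ≟ v
  ...   | yes _ = refl
  ...   | no  _ = refl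

  edge : Swap → Edge
  edge (_ , _ , e , _) = e

  applySwap-swap : ∀ σ f t → applySwap σ f t ≡ swap (edge σ) (f t)
  applySwap-swap (u , v , e , inj₁ (refl , refl)) f t = applySwap-transpose (e , inj₁ (refl , refl)) f t
  applySwap-swap (u , v , e , inj₂ (refl , refl)) f t =
    trans (applySwap-transpose (e , inj₂ (refl , refl)) f t) (transpose-comm u v (f t))

  applySwaps-run : ∀ ss f t → applySwaps ss f t ≡ run (map edge ss) (f t)
  applySwaps-run []       f t = refl
  applySwaps-run (σ ∷ ss) f t =
    trans (applySwaps-run ss (applySwap σ f) t) (cong (run (map edge ss)) (applySwap-swap σ f t))

  -- Invariantly, each token lies in the piece of its destination and each vertex carries a token. A
  -- swap between pieces joins ports of equal index and would take both its tokens further away.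
  local⇒internal : ∀ ss f → (∀ t → piece (f t) ≡ piece (F t)) → (∀ v → ∃[ t ] f t ≡ v) →
                   LocallyOptimalFrom f ss → All Internal (map edge ss)
  local⇒internal []       f home onto _ = []
  local⇒internal (σ@(u , v , a) ∷ ss) f home onto (¬worse , local) =
    int ∷ local⇒internal ss (applySwap σ f) home′ onto′ local
    where
    u∼v : piece u ≡ piece v
    u∼v with piece u ≟ᵖ piece v
    ... | yes eq = eq
    ... | no u≁v with crossing-Adj a u≁v | onto u | onto v
    ...   | i , pu , pv | t₁ , refl | t₂ , refl = contradiction
            (λ further₁ → leaving-is-further (Graph.symm graph a) pv pu (u≁v ∘ sym) (home t₂)
              (λ further₂ → ¬worse (t₁ , t₂ , refl , refl , further₁ , further₂)))
            (leaving-is-further a pu pv u≁v (home t₁))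
    internal-edge : ∀ {u v} (a : Adj u v) → piece u ≡ piece v → Internal (proj₁ a)
    internal-edge (e , inj₁ (refl , refl)) eq = eq
    internal-edge (e , inj₂ (refl , refl)) eq = sym eq
    int : Internal (edge σ)
    int = internal-edge a u∼v
    piece-swap : ∀ {e} → Internal e → ∀ x → piece (swap e x) ≡ piece x
    piece-swap {e} int x with position (src e) (tgt e) x
    ... | left          = trans (cong piece (transpose-left (src e) (tgt e))) (sym int)
    ... | right         = trans (cong piece (transpose-right (src e) (tgt e))) int
    ... | other x≢s x≢t = cong piece (transpose-other x≢s x≢t)
    home′ : ∀ t → piece (applySwap σ f t) ≡ piece (F t)
    home′ t = trans (cong piece (applySwap-swap σ f t)) (trans (piece-swap int (f t)) (home t))
    onto′ : ∀ v → ∃[ t ] applySwap σ f t ≡ v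
    onto′ v with onto (swap (edge σ) v)
    ... | t , eq = t , trans (applySwap-swap σ f t) (trans (cong (swap (edge σ)) eq) (swap-involutive (edge σ) v))

  local-bound : ∀ ss → Solves ss → LocallyOptimal ss → s * k′ * (r + ℓ) ≤ length ss
  local-bound ss solves local = subst (s * k′ * (r + ℓ) ≤_) (Listₚ.length-map edge ss)
    (lower-bound (map edge ss)
      (local⇒internal ss id (λ t → sym (piece-F t)) (λ v → v , refl) local)
      (λ x → trans (sym (applySwaps-run ss id x)) (solves x)))

  swapAlong : Edge → Swap
  swapAlong e = src e , tgt e , forward e

  schedule-solves : Solves (map swapAlong schedule)
  schedule-solves t = trans (applySwaps-run (map swapAlong schedule) id t)
    (cong (λ es → run es t) (trans (sym (Listₚ.map-∘ schedule)) (Listₚ.map-id schedule)))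

  OPT-bound : ∃[ opt ] IsOPT opt × opt ≤ suc k * s * suc R
  OPT-bound with OPT-exists K (map swapAlong schedule) schedule-solves
  ... | opt , isOPT , opt≤ = opt , isOPT , ℕₚ.≤-trans opt≤
    (ℕₚ.≤-reflexive (trans (Listₚ.length-map swapAlong schedule) (length-pulls 0 horizon)))

  -- The empty sequence is locally optimal; if it solved the instance, `local-bound` would bound a
  -- positive number by zero.
  OPT-positive : ∀ {opt} → 0 < k′ → IsOPT opt → 0 < opt
  OPT-positive {suc opt} _  _                       = s≤s z≤n
  OPT-positive {zero} 0<k′ (([] , solves , refl) , _) = contradiction
    (ℕₚ.<-≤-trans (ℕₚ.*-mono-≤ (ℕₚ.*-mono-≤ (s≤s (z≤n {k * R})) 0<k′) (s≤s (z≤n {ℓ + ℓ})))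
      (local-bound [] solves tt)) λ ()

-- Comparison of the two bounds

module Ratio where
  open import Data.Nat.Base using (_≤_; _+_; _*_)

  -- With k = R = n + 1 the ratio of the two bounds is at least 4 - 13 / (n + 2).
  bounds-compare : ∀ n d s → suc (suc n) ≡ 13 * suc d →
    4 * suc d * (suc (suc n) * s * suc (suc n)) ≤
    s * n * (suc (suc (n + n)) + suc (n + n)) * suc d + suc (suc n) * s * suc (suc n)
  bounds-compare n d s eq = begin
    4 * suc d * (suc (suc n) * s * suc (suc n))
      -- The added term is the exact difference of the two sides once `n + 2` is written as
      -- `13 * suc d`.
      ≤⟨ ℕₚ.m≤m+n _ (10 * s * suc d) ⟩
    4 * suc d * (suc (suc n) * s * suc (suc n)) + 10 * s * suc d
      ≡⟨ identity n (suc d) s ⟩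
    s * n * (suc (suc (n + n)) + suc (n + n)) * suc d + 13 * suc d * s * suc (suc n)
      ≡⟨ cong (λ m → s * n * (suc (suc (n + n)) + suc (n + n)) * suc d + m * s * suc (suc n)) eq ⟨
    s * n * (suc (suc (n + n)) + suc (n + n)) * suc d + suc (suc n) * s * suc (suc n)
      ∎
    where
    open ℕₚ.≤-Reasoning
    identity : ∀ n D s → 4 * D * (suc (suc n) * s * suc (suc n)) + 10 * s * D ≡
      s * n * (suc (suc (n + n)) + suc (n + n)) * D + 13 * D * s * suc (suc n)
    identity = ℕ-Solver.solve-∀

  -- With `D = d + 1`, the hypothesis is `(4 - 1/D) * U ≤ B` cleared of denominators. Lowering `U`
  -- to `opt` by `x` takes `4 * D * x` off the left side and only `x` off the right.
  transfer : ∀ {d opt U B len} → opt ≤ U → B ≤ len →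
    4 * suc d * U ≤ B * suc d + U → 4 * suc d * opt ≤ len * suc d + opt
  transfer {d} {opt} {U} {B} {len} opt≤U B≤len compare with ℕₚ.m≤n⇒∃[o]m+o≡n opt≤U
  ... | x , refl = ℕₚ.+-cancelʳ-≤ x _ _ (begin
    4 * suc d * opt + x                     ≤⟨ ℕₚ.+-monoʳ-≤ (4 * suc d * opt) (ℕₚ.m≤n*m x (4 * suc d)) ⟩
    4 * suc d * opt + 4 * suc d * x         ≡⟨ ℕₚ.*-distribˡ-+ (4 * suc d) opt x ⟨
    4 * suc d * (opt + x)                   ≤⟨ compare ⟩
    B * suc d + (opt + x)                   ≤⟨ ℕₚ.+-monoˡ-≤ (opt + x) (ℕₚ.*-monoˡ-≤ (suc d) B≤len) ⟩
    len * suc d + (opt + x)                 ≡⟨ ℕₚ.+-assoc (len * suc d) opt x ⟨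
    len * suc d + opt + x                   ∎)
    where open ℕₚ.≤-Reasoning

open Ratio

-- Passage to rational numbers and the final choice of parameters

open import Data.Integer.Base using (+_; +[1+_])
open import Data.Rational.Base using (ℚ; 0ℚ; _/_; _-_; _*_; _≤_; _<_; mkℚ; toℚᵘ; *<*)

-- For `δ = (a + 1) / (d + 1)` this is the cross-multiplied inequality to which the order on
-- unnormalised rationals unfolds, whence the factors 1. Since `a + 1` is at least 1, subtracting
-- `(a + 1) * opt` absorbs the extra `opt`.
integral-bound : ∀ a d opt len → 4 ℕ.* suc d ℕ.* opt ℕ.≤ len ℕ.* suc d ℕ.+ opt →
  (+ 4 ℤ.* + suc d ℤ.+ ℤ.-[1+ a ] ℤ.* + 1) ℤ.* + opt ℤ.* + 1 ℤ.≤ + len ℤ.* + (1 ℕ.* suc d ℕ.* 1)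
integral-bound a d opt len bound = begin
  (+ 4 ℤ.* + suc d ℤ.+ ℤ.-[1+ a ] ℤ.* + 1) ℤ.* + opt ℤ.* + 1
    ≡⟨ regroup (+ suc d) +[1+ a ] (+ opt) ⟩
  + 4 ℤ.* + suc d ℤ.* + opt ℤ.- +[1+ a ] ℤ.* + opt
    ≡⟨ cong₂ ℤ._-_ (ℤₚ.pos-* (4 ℕ.* suc d) opt) (ℤₚ.pos-* (suc a) opt) ⟨
  + (4 ℕ.* suc d ℕ.* opt) ℤ.- + (suc a ℕ.* opt)
    ≤⟨ ℤₚ.+-mono-≤ (ℤ.+≤+ bound) (ℤₚ.neg-mono-≤ (ℤ.+≤+ (ℕₚ.m≤m+n opt (a ℕ.* opt)))) ⟩
  + (len ℕ.* suc d) ℤ.+ + opt ℤ.- + opt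
    ≡⟨ cancel (+ (len ℕ.* suc d)) (+ opt) ⟩
  + (len ℕ.* suc d)
    ≡⟨ ℤₚ.pos-* len (suc d) ⟩
  + len ℤ.* + suc d
    ≡⟨ cong (λ n → + len ℤ.* + n) (trans (ℕₚ.*-identityʳ (1 ℕ.* suc d)) (ℕₚ.*-identityˡ (suc d))) ⟨
  + len ℤ.* + (1 ℕ.* suc d ℕ.* 1)
    ∎
  where
  open ℤₚ.≤-Reasoning
  regroup : ∀ D A O → (+ 4 ℤ.* D ℤ.+ ℤ.- A ℤ.* + 1) ℤ.* O ℤ.* + 1 ≡ + 4 ℤ.* D ℤ.* O ℤ.- A ℤ.* O
  regroup = ℤ-Solver.solve-∀
  cancel : ∀ L O → L ℤ.+ O ℤ.- O ≡ L
  cancel = ℤ-Solver.solve-∀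

-- The computation takes place in unnormalised rationals, where sums and products are not reduced to
-- lowest terms.
rational-bound : ∀ a d .(c : Coprime (suc a) (suc d)) opt len → 4 ℕ.* suc d ℕ.* opt ℕ.≤ len ℕ.* suc d ℕ.+ opt →
  (+ 4 / 1 - mkℚ +[1+ a ] d c) * (+ opt / 1) ≤ + len / 1
rational-bound a d c opt len bound = ℚₚ.toℚᵘ-cancel-≤ (begin
  toℚᵘ ((+ 4 / 1 - δ) * (+ opt / 1))                ≃⟨ ℚₚ.toℚᵘ-homo-* (+ 4 / 1 - δ) (+ opt / 1) ⟩
  toℚᵘ (+ 4 / 1 - δ) ℚᵘ.* toℚᵘ (+ opt / 1)          ≃⟨ ℚᵘₚ.*-cong (ℚₚ.toℚᵘ-homo-+ (+ 4 / 1) (ℚ.- δ)) (ℚₚ.toℚᵘ-fromℚᵘ (mkℚᵘ (+ opt) 0)) ⟩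
  (toℚᵘ (+ 4 / 1) ℚᵘ.+ toℚᵘ (ℚ.- δ)) ℚᵘ.* mkℚᵘ (+ opt) 0  ≤⟨ *≤* (integral-bound a d opt len bound) ⟩
  mkℚᵘ (+ len) 0                                    ≃⟨ ℚₚ.toℚᵘ-fromℚᵘ (mkℚᵘ (+ len) 0) ⟨
  toℚᵘ (+ len / 1)                                  ∎)
  where
  δ = mkℚ +[1+ a ] d c
  open ℚᵘₚ.≤-Reasoning

module _ (n a d : ℕ) .(c : Coprime (suc a) (suc d)) (2+n≡ : suc (suc n) ≡ 13 ℕ.* suc d) (0<n : 0 ℕ.< n) where
  open LowerBound n n
  open Instance K

  local-ratio : Σ[ opt ∈ ℕ ] (IsOPT opt × 0 ℕ.< opt × ((ss : List Swap) → Solves ss → LocallyOptimal ss →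
    (+ 4 / 1 - mkℚ +[1+ a ] d c) * (+ opt / 1) ≤ + length ss / 1))
  local-ratio with OPT-bound
  ... | opt , isOPT , opt≤ = opt , isOPT , OPT-positive 0<n isOPT , λ ss solves local →
    rational-bound a d c opt (length ss)
      (transfer {d} opt≤ (local-bound ss solves local) (bounds-compare n d (Construction.s n n) 2+n≡))

theorem1p3 : (δ : ℚ) → 0ℚ < δ →
    Σ[ K ∈ Instance ] (let open Instance K in
    Σ[ opt ∈ ℕ ] (IsOPT opt × 0 ℕ.< opt ×
    ((ss : List Swap) → Solves ss → LocallyOptimal ss →
    (+ 4 / 1 - δ) * (+ opt / 1) ≤ + length ss / 1)))
theorem1p3 (mkℚ (+ 0)      d c) (*<* (ℤ.+<+ ()))
theorem1p3 (mkℚ ℤ.-[1+ a ] d c) (*<* ())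
theorem1p3 (mkℚ +[1+ a ]   d c) _ =
  LowerBound.K n n , local-ratio n a d c (sym (ℕₚ.*-suc 13 d)) (ℕ.s≤s ℕ.z≤n)
  where
  n : ℕ
  -- Then `n + 2 = 13 * (d + 1)`, so the loss `13 / (n + 2)` equals `1 / (d + 1)`, which is at most
  -- `δ = (a + 1) / (d + 1)`.
  n = 11 ℕ.+ 13 ℕ.* d
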